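{- Let $d\ge1$ and let $\Omega=H_1\times H_2\times\cdots\times H_d$ be a product of finite nonempty sets, equipped with the $\ell_0$ metric $d(x,y)=|\{i:x_i\ne y_i\}|$. Then $\Omega$ has Brunn-Minkowski curvature at least $\frac{1}{2d}$; that is, for all nonempty $S,T\subseteq\Omega$, $$|\widehat{m}(S,T)|\ge\sqrt{|S||T|}\;e^{\frac{1}{16d}d_*(S,T)^2}.$$
   Context: For points $a,b$, the symmetric discrete midpoints are $$\widehat{m}(a,b)=\{u: d(a,u)=\lfloor d(a,b)/2\rfloor,\ d(a,u)+d(u,b)=d(a,b)\}\cup\{u: d(a,u)=\lceil d(a,b)/2\rceil,\ d(a,u)+d(u,b)=d(a,b)\},$$ and $\widehat{m}(S,T)=\bigcup_{s\in S,t\in T}\widehat{m}(s,t)$. Also $d_*(S,T)=\min\{d(s,t):s\in S,t\in T\}$. The Brunn-Minkowski curvature is the supremum of the values $K$ such that $|\widehat{m}(S,T)|\ge\sqrt{|S||T|}\,e^{\frac K8 d_*(S,T)^2}$ for all nonempty sets $S,T$. -}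

module Defs where

open import Data.Fin.Base using (Fin; zero; suc)
import Data.Fin.Properties as Fin
import Data.Integer.Base as ℤ
import Data.Integer.Properties as ℤ
open import Data.List.Base as List using (List; length; filter; allFin; cartesianProductWith)
open import Data.List.Extrema.Nat using (min)
open import Data.Nat.Base as ℕ using (ℕ; zero; suc; ⌊_/2⌋; ⌈_/2⌉; z≤n; s≤s)
import Data.Nat.Properties as ℕ
open import Data.Product.Base using (∃; ∃-syntax; ∃₂; _×_; _,_; proj₁; proj₂)
open import Data.Product.Function.NonDependent.Propositional using (_×-↔_)
open import Data.Rational.Base as ℚ using (ℚ; 0ℚ; 1ℚ; mkℚ; _/_; toℚᵘ)
import Data.Rational.Properties as ℚ
import Data.Rational.Unnormalised.Base as ℚᵘ
import Data.Rational.Unnormalised.Properties as ℚᵘ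
open import Data.Sum.Base using (_⊎_; inj₁; inj₂)
open import Data.Unit.Base using (⊤)
open import Data.Vec.Base as Vec using (Vec; []; _∷_)
open import Function.Base using (_∘_)
open import Function.Bundles using (_↔_; module Inverse)
open import Function.Properties.Inverse using (↔-sym; ↔-trans; Inverse⇒Injection)
open import Level using (0ℓ)
open import Relation.Binary.Definitions using (DecidableEquality)
open import Relation.Binary.PropositionalEquality
open import Relation.Nullary.Decidable using (Dec; map′; ¬?; _×-dec_; _⊎-dec_; via-injection)
open import Relation.Unary using (Pred; Decidable; Satisfiable; _∈_; _⊆_)

-- Real numbers as Dedekind cuts of ℚ, given by the lower half (without
-- greatest element) and ordered by inclusion. Locatedness is not demanded;
-- classically it is automatic.

record ℝ : Set₁ where
  field
    lower     : Pred ℚ 0ℓ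
    inhabited : Satisfiable lower
    bounded   : ∃[ B ] (∀ {q} → q ∈ lower → q ℚ.< B)
    closed    : ∀ {p q} → p ℚ.< q → q ∈ lower → p ∈ lower
    rounded   : ∀ {p} → p ∈ lower → ∃[ q ] p ℚ.< q × q ∈ lower

open ℝ public using (lower)

infix 4 _≤ℝ_

_≤ℝ_ : ℝ → ℝ → Set
x ≤ℝ y = lower x ⊆ lower y

private
  p-1<p : ∀ p → p ℚ.- 1ℚ ℚ.< p
  p-1<p p = subst (p ℚ.- 1ℚ ℚ.<_) (ℚ.+-identityʳ p)
    (ℚ.+-monoʳ-< p (ℚ.negative⁻¹ (ℚ.- 1ℚ)))

sup : (A : Pred ℚ 0ℓ) → Satisfiable A → ∃[ B ] (∀ {q} → q ∈ A → q ℚ.≤ B) → ℝ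
sup A (a , a∈A) (B , A≤B) = record
  { lower     = λ q → ∃[ r ] q ℚ.< r × r ∈ A
  ; inhabited = a ℚ.- 1ℚ , a , p-1<p a , a∈A
  ; bounded   = B , λ (r , q<r , r∈A) → ℚ.<-≤-trans q<r (A≤B r∈A)
  ; closed    = λ p<q (r , q<r , r∈A) → r , ℚ.<-trans p<q q<r , r∈A
  ; rounded   = λ (r , p<r , r∈A) →
      let m , p<m , m<r = ℚ.<-dense p<r in m , p<m , r , m<r , r∈A
  }

ℕtoℚ : ℕ → ℚ
ℕtoℚ n = ℤ.+ n / 1

ℕtoℝ : ℕ → ℝ
ℕtoℝ n = sup (_≡ ℕtoℚ n) (_ , refl) (ℕtoℚ n , ℚ.≤-reflexive)

private
  toᵘ-/1 : ∀ n → toℚᵘ (ℕtoℚ n) ℚᵘ.≃ (ℤ.+ n ℚᵘ./ 1)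
  toᵘ-/1 n = ℚ.toℚᵘ-fromℚᵘ (ℤ.+ n ℚᵘ./ 1)

  ℕtoℚ-mono : ∀ m n → m ℕ.≤ n → ℕtoℚ m ℚ.≤ ℕtoℚ n
  ℕtoℚ-mono m n m≤n = ℚ.toℚᵘ-cancel-≤
    (ℚᵘ.≤-respˡ-≃ (ℚᵘ.≃-sym (toᵘ-/1 m)) (ℚᵘ.≤-respʳ-≃ (ℚᵘ.≃-sym (toᵘ-/1 n))
      (ℚᵘ.*≤* (ℤ.*-monoʳ-≤-nonNeg (ℤ.+ 1) (ℤ.+≤+ m≤n)))))

  ℕtoℚ-+ : ∀ m n → ℕtoℚ m ℚ.+ ℕtoℚ n ≡ ℕtoℚ (m ℕ.+ n)
  ℕtoℚ-+ m n = ℚ.toℚᵘ-injective (begin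
    toℚᵘ (ℕtoℚ m ℚ.+ ℕtoℚ n)              ≈⟨ ℚ.toℚᵘ-homo-+ (ℕtoℚ m) (ℕtoℚ n) ⟩
    toℚᵘ (ℕtoℚ m) ℚᵘ.+ toℚᵘ (ℕtoℚ n)      ≈⟨ ℚᵘ.+-cong (toᵘ-/1 m) (toᵘ-/1 n) ⟩
    (ℤ.+ m ℚᵘ./ 1) ℚᵘ.+ (ℤ.+ n ℚᵘ./ 1)    ≈⟨ ℚᵘ.*≡* (cong (ℤ._* ℤ.+ 1)
                                              (cong₂ ℤ._+_ (ℤ.*-identityʳ (ℤ.+ m)) (ℤ.*-identityʳ (ℤ.+ n)))) ⟩
    (ℤ.+ (m ℕ.+ n) ℚᵘ./ 1)                ≈⟨ ℚᵘ.≃-sym (toᵘ-/1 (m ℕ.+ n)) ⟩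
    toℚᵘ (ℕtoℚ (m ℕ.+ n))                 ∎)
    where open ℚᵘ.≃-Reasoning

  suc/1*1/suc : ∀ n → ℕtoℚ (suc n) ℚ.* (ℤ.+ 1 / suc n) ≡ 1ℚ
  suc/1*1/suc n = ℚ.toℚᵘ-injective (begin
    toℚᵘ (ℕtoℚ (suc n) ℚ.* (ℤ.+ 1 / suc n))          ≈⟨ ℚ.toℚᵘ-homo-* (ℕtoℚ (suc n)) (ℤ.+ 1 / suc n) ⟩
    toℚᵘ (ℕtoℚ (suc n)) ℚᵘ.* toℚᵘ (ℤ.+ 1 / suc n)    ≈⟨ ℚᵘ.*-cong (toᵘ-/1 (suc n)) (ℚ.toℚᵘ-fromℚᵘ (ℤ.+ 1 ℚᵘ./ suc n)) ⟩
    (ℤ.+ suc n ℚᵘ./ 1) ℚᵘ.* (ℤ.+ 1 ℚᵘ./ suc n)       ≈⟨ ℚᵘ.*≡* (cong ℤ.+_ eq) ⟩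
    ℚᵘ.1ℚᵘ                                           ∎)
    where
    open ℚᵘ.≃-Reasoning
    eq : suc n ℕ.* 1 ℕ.* 1 ≡ 1 ℕ.* (1 ℕ.* suc n)
    eq = trans (ℕ.*-identityʳ _) (trans (ℕ.*-identityʳ _)
           (sym (trans (ℕ.*-identityˡ _) (ℕ.*-identityˡ _))))

  ∣p∣≤∣↥p∣ : ∀ p → ℚ.∣ p ∣ ℚ.≤ ℕtoℚ ℤ.∣ ℚ.↥ p ∣
  ∣p∣≤∣↥p∣ p@(mkℚ n d-1 _) = ℚ.toℚᵘ-cancel-≤
    (ℚᵘ.≤-respʳ-≃ (ℚᵘ.≃-sym (toᵘ-/1 ℤ.∣ n ∣))
      (ℚᵘ.*≤* (ℤ.*-monoˡ-≤-nonNeg (ℤ.+ ℤ.∣ n ∣) {ℤ.+ 1} {ℤ.+ suc d-1} (ℤ.+≤+ (s≤s z≤n)))))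

  *-mono-nonNeg : ∀ {a b c d} → 0ℚ ℚ.≤ b → 0ℚ ℚ.≤ c →
                  a ℚ.≤ c → b ℚ.≤ d → a ℚ.* b ℚ.≤ c ℚ.* d
  *-mono-nonNeg {a} {b} {c} {d} 0≤b 0≤c a≤c b≤d = ℚ.≤-trans
    (ℚ.*-monoʳ-≤-nonNeg b {{ℚ.nonNegative 0≤b}} a≤c)
    (ℚ.*-monoˡ-≤-nonNeg c {{ℚ.nonNegative 0≤c}} b≤d)

  p≤1+n : ∀ n {p} → p ℚ.* p ℚ.≤ ℕtoℚ n → p ℚ.≤ ℕtoℚ (suc n)
  p≤1+n n {p} p²≤n with ℚ.≤-total p (ℕtoℚ (suc n))
  ... | inj₁ p≤ = p≤
  ... | inj₂ 1+n≤p = ℚ.≤-trans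
    (subst (ℚ._≤ p ℚ.* p) (ℚ.*-identityʳ p)
      (ℚ.*-monoˡ-≤-nonNeg p {{ℚ.nonNegative (ℚ.≤-trans (ℕtoℚ-mono 0 (suc n) z≤n) 1+n≤p)}}
        (ℚ.≤-trans (ℕtoℚ-mono 1 (suc n) (s≤s z≤n)) 1+n≤p)))
    (ℚ.≤-trans p²≤n (ℕtoℚ-mono n (suc n) (ℕ.n≤1+n n)))

√ : ℕ → ℝ
√ n = sup (λ r → r ℚ.* r ℚ.≤ ℕtoℚ n)
          (0ℚ , ℕtoℚ-mono 0 n z≤n)
          (ℕtoℚ (suc n) , p≤1+n n)

-- The product of nonnegative reals (the only case in which it is used);
-- 0 is adjoined because a zero factor has no nonnegative rational below it.

infixl 7 _*₊_

_*₊_ : ℝ → ℝ → ℝ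
x *₊ y = sup
  (λ r → r ≡ 0ℚ ⊎ ∃₂ λ a b → 0ℚ ℚ.≤ a × 0ℚ ℚ.≤ b × a ∈ lower x × b ∈ lower y × r ≡ a ℚ.* b)
  (0ℚ , inj₁ refl)
  (X ℚ.* Y , λ where
    (inj₁ refl) → subst (ℚ._≤ X ℚ.* Y) (ℚ.*-zeroˡ 0ℚ) (*-mono-nonNeg ℚ.≤-refl 0≤X 0≤X 0≤Y)
    (inj₂ (a , b , 0≤a , 0≤b , a∈x , b∈y , refl)) → *-mono-nonNeg 0≤b 0≤X
      (ℚ.≤-trans (ℚ.<⇒≤ (proj₂ (ℝ.bounded x) a∈x)) (ℚ.p≤p⊔q _ 0ℚ))
      (ℚ.≤-trans (ℚ.<⇒≤ (proj₂ (ℝ.bounded y) b∈y)) (ℚ.p≤p⊔q _ 0ℚ)))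
  where
  X = proj₁ (ℝ.bounded x) ℚ.⊔ 0ℚ
  Y = proj₁ (ℝ.bounded y) ℚ.⊔ 0ℚ
  0≤X : 0ℚ ℚ.≤ X
  0≤X = ℚ.p≤q⊔p (proj₁ (ℝ.bounded x)) 0ℚ
  0≤Y : 0ℚ ℚ.≤ Y
  0≤Y = ℚ.p≤q⊔p (proj₁ (ℝ.bounded y)) 0ℚ

EventuallyBounded : (ℕ → ℚ) → Set
EventuallyBounded a = ∃₂ λ N B → ∀ n → N ℕ.≤ n → ℚ.∣ a n ∣ ℚ.≤ B

private
  p≤∣p∣ : ∀ p → p ℚ.≤ ℚ.∣ p ∣
  p≤∣p∣ p with ℚ.≤-total 0ℚ p
  ... | inj₁ 0≤p = ℚ.≤-reflexive (sym (ℚ.0≤p⇒∣p∣≡p 0≤p))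
  ... | inj₂ p≤0 = ℚ.≤-trans p≤0 (ℚ.0≤∣p∣ p)

  -∣p∣≤p : ∀ p → ℚ.- ℚ.∣ p ∣ ℚ.≤ p
  -∣p∣≤p p = subst (ℚ.- ℚ.∣ p ∣ ℚ.≤_) (⁻¹-involutive p)
    (ℚ.neg-antimono-≤ (subst (ℚ.- p ℚ.≤_) (ℚ.∣-p∣≡∣p∣ p) (p≤∣p∣ (ℚ.- p))))
    where open import Algebra.Properties.Group ℚ.+-0-group using (⁻¹-involutive)

-- The limit inferior, hence the limit of any convergent sequence.

lim : (a : ℕ → ℚ) → EventuallyBounded a → ℝ
lim a (N , B , a≤B) = sup
  (λ r → ∃[ M ] (∀ n → M ℕ.≤ n → r ℚ.≤ a n))
  (ℚ.- B , N , λ n N≤n → ℚ.≤-trans (ℚ.neg-antimono-≤ (a≤B n N≤n)) (-∣p∣≤p (a n)))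
  (B , λ (M , r≤a) → ℚ.≤-trans (r≤a (M ℕ.⊔ N) (ℕ.m≤m⊔n M N))
    (ℚ.≤-trans (p≤∣p∣ _) (a≤B (M ℕ.⊔ N) (ℕ.m≤n⊔m M N))))

-- expTerm x j = xʲ / j!  and  expSum x n = Σ_{j<n} xʲ / j!

expTerm : ℚ → ℕ → ℚ
expTerm x zero    = 1ℚ
expTerm x (suc j) = expTerm x j ℚ.* (x ℚ.* (ℤ.+ 1 / suc j))

expSum : ℚ → ℕ → ℚ
expSum x zero    = 0ℚ
expSum x (suc n) = expSum x n ℚ.+ expTerm x n

-- With ∣x∣ ≤ A and n ≥ 2A, ∣t (suc n)∣ ≤ ∣t n∣ / 2 for t = expTerm x, so
-- Σ_{j<n} ∣t j∣ + 2 ∣t n∣ is nonincreasing in n from 2A onwards.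

private
  module ExpBound (x : ℚ) where
    A N : ℕ
    A = ℤ.∣ ℚ.↥ x ∣
    N = A ℕ.+ A

    t T G : ℕ → ℚ
    t n = ℚ.∣ expTerm x n ∣
    T zero    = 0ℚ
    T (suc n) = T n ℚ.+ t n
    G n = T n ℚ.+ (t n ℚ.+ t n)

    ∣expSum∣≤T : ∀ n → ℚ.∣ expSum x n ∣ ℚ.≤ T n
    ∣expSum∣≤T zero    = ℚ.≤-refl
    ∣expSum∣≤T (suc n) = ℚ.≤-trans (ℚ.∣p+q∣≤∣p∣+∣q∣ (expSum x n) (expTerm x n))
      (ℚ.+-monoˡ-≤ (t n) (∣expSum∣≤T n))

    T≤G : ∀ n → T n ℚ.≤ G n
    T≤G n = subst (ℚ._≤ G n) (ℚ.+-identityʳ (T n))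
      (ℚ.+-monoʳ-≤ (T n) (ℚ.+-mono-≤ (ℚ.0≤∣p∣ (expTerm x n)) (ℚ.0≤∣p∣ (expTerm x n))))

    ratio : ∀ n → N ℕ.≤ n → let u = ℤ.+ 1 / suc n in
            ℚ.∣ x ℚ.* u ∣ ℚ.+ ℚ.∣ x ℚ.* u ∣ ℚ.≤ 1ℚ
    ratio n N≤n = begin
      ℚ.∣ x ℚ.* u ∣ ℚ.+ ℚ.∣ x ℚ.* u ∣   ≡⟨ cong₂ ℚ._+_ ∣xu∣ ∣xu∣ ⟩
      ℚ.∣ x ∣ ℚ.* u ℚ.+ ℚ.∣ x ∣ ℚ.* u   ≡⟨ sym (ℚ.*-distribʳ-+ u ℚ.∣ x ∣ ℚ.∣ x ∣) ⟩
      (ℚ.∣ x ∣ ℚ.+ ℚ.∣ x ∣) ℚ.* u       ≤⟨ ℚ.*-monoʳ-≤-nonNeg u (ℚ.+-mono-≤ (∣p∣≤∣↥p∣ x) (∣p∣≤∣↥p∣ x)) ⟩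
      (ℕtoℚ A ℚ.+ ℕtoℚ A) ℚ.* u         ≡⟨ cong (ℚ._* u) (ℕtoℚ-+ A A) ⟩
      ℕtoℚ N ℚ.* u                      ≤⟨ ℚ.*-monoʳ-≤-nonNeg u (ℕtoℚ-mono N (suc n) (ℕ.m≤n⇒m≤1+n N≤n)) ⟩
      ℕtoℚ (suc n) ℚ.* u                ≡⟨ suc/1*1/suc n ⟩
      1ℚ                                ∎
      where
      open ℚ.≤-Reasoning
      u = ℤ.+ 1 / suc n
      instance
        u≥0 : ℚ.NonNegative u
        u≥0 = ℚ.normalize-nonNeg 1 (suc n)
      ∣xu∣ : ℚ.∣ x ℚ.* u ∣ ≡ ℚ.∣ x ∣ ℚ.* u
      ∣xu∣ = trans (ℚ.∣p*q∣≡∣p∣*∣q∣ x u)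
        (cong (ℚ.∣ x ∣ ℚ.*_) (ℚ.0≤p⇒∣p∣≡p (ℚ.nonNegative⁻¹ u)))

    halving : ∀ n → N ℕ.≤ n → t (suc n) ℚ.+ t (suc n) ℚ.≤ t n
    halving n N≤n = begin
      t (suc n) ℚ.+ t (suc n)     ≡⟨ cong₂ ℚ._+_ eq eq ⟩
      t n ℚ.* c ℚ.+ t n ℚ.* c     ≡⟨ sym (ℚ.*-distribˡ-+ (t n) c c) ⟩
      t n ℚ.* (c ℚ.+ c)           ≤⟨ ℚ.*-monoˡ-≤-nonNeg (t n) {{ℚ.∣-∣-nonNeg (expTerm x n)}} (ratio n N≤n) ⟩
      t n ℚ.* 1ℚ                  ≡⟨ ℚ.*-identityʳ (t n) ⟩
      t n                         ∎
      where
      open ℚ.≤-Reasoning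
      c = ℚ.∣ x ℚ.* (ℤ.+ 1 / suc n) ∣
      eq : t (suc n) ≡ t n ℚ.* c
      eq = ℚ.∣p*q∣≡∣p∣*∣q∣ (expTerm x n) (x ℚ.* (ℤ.+ 1 / suc n))

    G-step : ∀ n → N ℕ.≤ n → G (suc n) ℚ.≤ G n
    G-step n N≤n = begin
      T n ℚ.+ t n ℚ.+ (t (suc n) ℚ.+ t (suc n))   ≤⟨ ℚ.+-monoʳ-≤ (T n ℚ.+ t n) (halving n N≤n) ⟩
      T n ℚ.+ t n ℚ.+ t n                         ≡⟨ ℚ.+-assoc (T n) (t n) (t n) ⟩
      G n                                         ∎
      where open ℚ.≤-Reasoning

    G-anti : ∀ {n} → N ℕ.≤′ n → G n ℚ.≤ G N
    G-anti (ℕ.≤′-reflexive refl) = ℚ.≤-refl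
    G-anti {suc n} (ℕ.≤′-step N≤n) = ℚ.≤-trans (G-step n (ℕ.≤′⇒≤ N≤n)) (G-anti N≤n)

    bound : EventuallyBounded (expSum x)
    bound = N , G N , λ n N≤n →
      ℚ.≤-trans (∣expSum∣≤T n) (ℚ.≤-trans (T≤G n) (G-anti (ℕ.≤⇒≤′ N≤n)))

exp : ℚ → ℝ
exp x = lim (expSum x) (ExpBound.bound x)

record FiniteSet : Set₁ where
  field
    Carrier : Set
    size    : ℕ
    enum    : Carrier ↔ Fin size

  _≟_ : DecidableEquality Carrier
  _≟_ = via-injection (Inverse⇒Injection enum) Fin._≟_

  elements : List Carrier
  elements = List.map (Inverse.from enum) (allFin size)

  any? : ∀ {P : Pred Carrier 0ℓ} → Decidable P → Dec (∃ P)
  any? {P} P? = map′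
    (λ (i , p) → Inverse.from enum i , p)
    (λ (x , p) → Inverse.to enum x , subst P (sym (Inverse.strictlyInverseʳ enum x)) p)
    (Fin.any? (P? ∘ Inverse.from enum))

open FiniteSet public using (Carrier; size)

Inhabited : FiniteSet → Set
Inhabited X = Carrier X

-- Decidability is what makes the cardinality of a subset a natural number.

record Subset (X : FiniteSet) : Set₁ where
  field
    member  : Pred (Carrier X) 0ℓ
    member? : Decidable member

  toList : List (Carrier X)
  toList = filter member? (FiniteSet.elements X)

open Subset public

∣_∣ : ∀ {X} → Subset X → ℕ
∣ S ∣ = length (toList S)

Nonempty : ∀ {X} → Subset X → Set
Nonempty S = ∃ (member S)

module BrunnMinkowski (X : FiniteSet) (dist : Carrier X → Carrier X → ℕ) where

  Midpoint : (a b u : Carrier X) → Set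
  Midpoint a b u =
    (dist a u ≡ ⌊ dist a b /2⌋ × dist a u ℕ.+ dist u b ≡ dist a b) ⊎
    (dist a u ≡ ⌈ dist a b /2⌉ × dist a u ℕ.+ dist u b ≡ dist a b)

  private
    midpoint? : ∀ a b → Decidable (Midpoint a b)
    midpoint? a b u =
      (dist a u ℕ.≟ _ ×-dec dist a u ℕ.+ dist u b ℕ.≟ _) ⊎-dec
      (dist a u ℕ.≟ _ ×-dec dist a u ℕ.+ dist u b ℕ.≟ _)

  m̂ : Subset X → Subset X → Subset X
  m̂ S T = record
    { member  = λ u → ∃[ s ] ∃[ t ] (member S s × member T t × Midpoint s t u)
    ; member? = λ u → FiniteSet.any? X λ s → FiniteSet.any? X λ t →
        member? S s ×-dec member? T t ×-dec midpoint? s t u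
    }

  -- `min` takes a default value; here it is one of the distances
  -- being minimised over.

  d⋆ : (S T : Subset X) → Nonempty S → Nonempty T → ℕ
  d⋆ S T (s , _) (t , _) =
    min (dist s t) (cartesianProductWith dist (toList S) (toList T))

  Inequality : ℚ → Set₁
  Inequality K = (S T : Subset X) (neS : Nonempty S) (neT : Nonempty T) →
    √ (∣ S ∣ ℕ.* ∣ T ∣) *₊ exp (K ℚ.* (ℤ.+ 1 / 8) ℚ.* ℕtoℚ (d⋆ S T neS neT ℕ.^ 2))
      ≤ℝ ℕtoℝ ∣ m̂ S T ∣

  -- κ ≤ sup { K ∣ Inequality K }, the supremum being +∞ when there is no
  -- upper bound. The set of valid K is closed downwards, so letting K and
  -- its upper bounds U range over ℚ instead of ℝ gives the same supremum.

  CurvatureAtLeast : ℚ → Set₁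
  CurvatureAtLeast κ = ∀ U → (∀ K → Inequality K → K ℚ.≤ U) → κ ℚ.≤ U

Π : ∀ {d} → Vec FiniteSet d → Set
Π []      = ⊤
Π (X ∷ H) = Carrier X × Π H

coord : ∀ {d} {H : Vec FiniteSet d} → Π H → (i : Fin d) → Carrier (Vec.lookup H i)
coord {H = _ ∷ _} (x , _)  zero    = x
coord {H = _ ∷ _} (_ , xs) (suc i) = coord xs i

Ω : ∀ {d} → Vec FiniteSet d → FiniteSet
Ω H = record { Carrier = Π H ; enum = enumΠ H }
  where
  sizeΠ : ∀ {d} → Vec FiniteSet d → ℕ
  sizeΠ []      = 1
  sizeΠ (X ∷ H) = size X ℕ.* sizeΠ H

  enumΠ : ∀ {d} (H : Vec FiniteSet d) → Π H ↔ Fin (sizeΠ H)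
  enumΠ []      = ↔-sym Fin.1↔⊤
  enumΠ (X ∷ H) = ↔-trans (FiniteSet.enum X ×-↔ enumΠ H) (↔-sym Fin.*↔×)

ℓ₀ : ∀ {d} (H : Vec FiniteSet d) → Π H → Π H → ℕ
ℓ₀ {d} H x y = length (filter (λ i → ¬? (same i)) (allFin d))
  where
  same : ∀ i → Dec (coord {H = H} x i ≡ coord {H = H} y i)
  same i = FiniteSet._≟_ (Vec.lookup H i) (coord {H = H} x i) (coord {H = H} y i)

{-# OPTIONS --safe #-}
module Submission where

-- Pair up consecutive coordinates at which u and v differ and let a fair coin
-- decide, for each pair, which one of the two is exchanged between u and v.
-- The points s and t obtained in this way have u and v as midpoints. This
-- random crossover preserves the counting measure of Ω × Ω, so |S||T| is the
-- sum of the probabilities p(u , v) that the crossover lands in S × T, and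
-- only u, v ∈ m̂ contribute. If two outcomes of the coins both lead to S × T, the
-- first point of one and the second point of the other have distance at least
-- D = d⋆(S , T), so the outcomes agree often. Induction over the coordinates
-- then gives the Chernoff bound p(u , v)² ≤ β⁻ᴰ cosh(log β)ᵈ for all β ≥ 1,
-- which is at most exp(−D²/4d) for β = 1 + D/d.

open import Defs
open import Algebra.Bundles using (CommutativeRing)
open import Data.Bool.Base using (Bool; true; false; not; if_then_else_)
open import Data.Fin.Base using (Fin; zero; suc; _↑ˡ_; _↑ʳ_; remQuot; combine)
import Data.Fin.Properties as Fin
import Data.Integer.Base as ℤ
import Data.Integer.Properties as ℤ
open import Data.List.Base as List using (length; filter; tabulate; allFin; cartesianProductWith)
open import Data.List.Extrema.Nat using (min≤xs)
import Data.List.Membership.Propositional as List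
open import Data.List.Membership.Propositional.Properties
  using (∈-map⁺; ∈-filter⁺; ∈-allFin; ∈-cartesianProductWith⁺)
open import Data.List.Properties using (length-filter; length-tabulate)
import Data.List.Relation.Unary.All as ListAll
open import Data.Nat.Base as ℕ using (ℕ; zero; suc; z≤n; s≤s; ⌊_/2⌋; ⌈_/2⌉)
import Data.Nat.Properties as ℕ
open import Data.Product.Base using (_×_; _,_; proj₁; proj₂)
open import Data.Product.Function.NonDependent.Propositional using (_×-↔_)
open import Data.Rational.Base as ℚ using (ℚ; 0ℚ; 1ℚ; ½; toℚᵘ; _/_)
import Data.Rational.Properties as ℚ
open import Data.Rational.Solver using (module +-*-Solver)
import Data.Rational.Unnormalised.Base as ℚᵘ
import Data.Rational.Unnormalised.Properties as ℚᵘ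
open import Data.Sum.Base as Sum using (_⊎_; inj₁; inj₂)
open import Data.Unit.Base using (tt)
open import Data.Vec.Base as Vec using (Vec; []; _∷_)
open import Data.Vec.Relation.Unary.All using (All)
open import Function.Base using (_∘_)
open import Function.Bundles using (_↔_; module Inverse)
open import Function.Properties.Inverse using (↔-sym; ↔-trans)
open import Level using (0ℓ)
open import Relation.Binary.PropositionalEquality
open import Relation.Nullary.Decidable using (Dec; yes; no; does; ¬?)
open import Relation.Nullary.Negation using (¬_; contradiction)
open import Relation.Unary using (Pred; Decidable)

-- Here `p(u , v)²` is a product of two averages over independent coins, and bounding it term by
-- term is too weak. Per pair of coordinates, equal coins cost β² and opposite coins cost 1; with
-- the mean (1 + β²)/2 per pair, the bound β⁻ᴰ((1 + β²)/2)^(d/2) is never below 1 when D ≤ d/2. The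
-- gain comes from u₀w₀ · u₁w₁ = u₀w₁ · u₁w₀: the two equal-coin terms have a product bounded by the
-- opposite-coin ones, so if one is as large as β², the other is at most β⁻². The mean drops to (2 +
-- β² + β⁻²)/4 = cosh(log β)², one factor cosh(log β) per coordinate. In other words, this is
-- concentration on the cube of coin outcomes, for a set and its image under flipping all coins,
-- which have Hamming distance at least D/2. Constants: p² ≤ exp(-D²/4d) gives |S||T| ≤ |m̂|²
-- exp(-D²/8d), and the square root gives 1/16d. The tilt log β = D/d with cosh t ≤ exp(t²/2) would
-- give exp(-D²/2d); the factor 2 pays for a rational β, so that no logarithm occurs and all
-- estimates compare rational partial sums.

module OrderedField where
  open import Data.Rational.Base using (_+_; _*_; _-_; -_; _≤_)
  open +-*-Solver

  open import Algebra.Definitions.RawSemiring ℚ.+-*-rawSemiring public using (_^_)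

  -- Arithmetic of nonnegative rationals.

  ℕtoℚ-mono-≤ : ∀ {m n} → m ℕ.≤ n → ℕtoℚ m ≤ ℕtoℚ n
  ℕtoℚ-mono-≤ {m} {n} m≤n = ℚ.toℚᵘ-cancel-≤
    (ℚᵘ.≤-respˡ-≃ (ℚᵘ.≃-sym (ℚ.toℚᵘ-fromℚᵘ (ℤ.+ m ℚᵘ./ 1)))
      (ℚᵘ.≤-respʳ-≃ (ℚᵘ.≃-sym (ℚ.toℚᵘ-fromℚᵘ (ℤ.+ n ℚᵘ./ 1)))
        (ℚᵘ.*≤* (ℤ.*-monoʳ-≤-nonNeg (ℤ.+ 1) (ℤ.+≤+ m≤n)))))

  ℕtoℚ-homo-+ : ∀ m n → ℕtoℚ (m ℕ.+ n) ≡ ℕtoℚ m + ℕtoℚ n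
  ℕtoℚ-homo-+ m n = ℚ.toℚᵘ-injective (begin
    toℚᵘ (ℕtoℚ (m ℕ.+ n))            ≈⟨ ℚ.toℚᵘ-fromℚᵘ (ℤ.+ (m ℕ.+ n) ℚᵘ./ 1) ⟩
    ℤ.+ (m ℕ.+ n) ℚᵘ./ 1             ≈⟨ ℚᵘ.*≡* (cong (ℤ._* ℤ.+ 1) (sym
                                          (cong₂ ℤ._+_ (ℤ.*-identityʳ (ℤ.+ m)) (ℤ.*-identityʳ (ℤ.+ n))))) ⟩
    (ℤ.+ m ℚᵘ./ 1) ℚᵘ.+ (ℤ.+ n ℚᵘ./ 1) ≈⟨ ℚᵘ.+-cong (ℚ.toℚᵘ-fromℚᵘ (ℤ.+ m ℚᵘ./ 1)) (ℚ.toℚᵘ-fromℚᵘ (ℤ.+ n ℚᵘ./ 1)) ⟨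
    toℚᵘ (ℕtoℚ m) ℚᵘ.+ toℚᵘ (ℕtoℚ n) ≈⟨ ℚ.toℚᵘ-homo-+ (ℕtoℚ m) (ℕtoℚ n) ⟨
    toℚᵘ (ℕtoℚ m + ℕtoℚ n)           ∎)
    where open ℚᵘ.≃-Reasoning

  ℕtoℚ-homo-* : ∀ m n → ℕtoℚ (m ℕ.* n) ≡ ℕtoℚ m * ℕtoℚ n
  ℕtoℚ-homo-* zero    n = sym (ℚ.*-zeroˡ (ℕtoℚ n))
  ℕtoℚ-homo-* (suc m) n = begin
    ℕtoℚ (n ℕ.+ m ℕ.* n)         ≡⟨ ℕtoℚ-homo-+ n (m ℕ.* n) ⟩
    ℕtoℚ n + ℕtoℚ (m ℕ.* n)      ≡⟨ cong (ℕtoℚ n +_) (ℕtoℚ-homo-* m n) ⟩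
    ℕtoℚ n + ℕtoℚ m * ℕtoℚ n     ≡⟨ solve 2 (λ m n → n :+ m :* n := (con 1ℚ :+ m) :* n) refl (ℕtoℚ m) (ℕtoℚ n) ⟩
    (1ℚ + ℕtoℚ m) * ℕtoℚ n       ≡⟨ cong (_* ℕtoℚ n) (ℕtoℚ-homo-+ 1 m) ⟨
    ℕtoℚ (suc m) * ℕtoℚ n        ∎
    where open ≡-Reasoning

  ℕtoℚ-*-inverse : ∀ n .{{_ : ℕ.NonZero n}} → ℕtoℚ n * (ℤ.+ 1 / n) ≡ 1ℚ
  ℕtoℚ-*-inverse n@(suc _) = ℚ.toℚᵘ-injective (begin
    toℚᵘ (ℕtoℚ n * (ℤ.+ 1 / n))              ≈⟨ ℚ.toℚᵘ-homo-* (ℕtoℚ n) (ℤ.+ 1 / n) ⟩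
    toℚᵘ (ℕtoℚ n) ℚᵘ.* toℚᵘ (ℤ.+ 1 / n)      ≈⟨ ℚᵘ.*-cong (ℚ.toℚᵘ-fromℚᵘ (ℤ.+ n ℚᵘ./ 1)) (ℚ.toℚᵘ-fromℚᵘ (ℤ.+ 1 ℚᵘ./ n)) ⟩
    (ℤ.+ n ℚᵘ./ 1) ℚᵘ.* (ℤ.+ 1 ℚᵘ./ n)       ≈⟨ ℚᵘ.*≡* (cong ℤ.+_ eq) ⟩
    ℚᵘ.1ℚᵘ                                   ∎)
    where
    open ℚᵘ.≃-Reasoning
    eq : n ℕ.* 1 ℕ.* 1 ≡ 1 ℕ.* (1 ℕ.* n)
    eq = trans (trans (ℕ.*-identityʳ _) (ℕ.*-identityʳ n))
           (sym (trans (ℕ.*-identityˡ _) (ℕ.*-identityˡ n)))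

  0≤1/n : ∀ n .{{_ : ℕ.NonZero n}} → 0ℚ ≤ ℤ.+ 1 / n
  0≤1/n n = ℚ.nonNegative⁻¹ (ℤ.+ 1 / n) {{ℚ.normalize-nonNeg 1 n}}

  0≤½ : 0ℚ ≤ ½
  0≤½ = 0≤1/n 2

  0≤ℕtoℚ : ∀ n → 0ℚ ≤ ℕtoℚ n
  0≤ℕtoℚ n = ℕtoℚ-mono-≤ {0} {n} z≤n

  *-monoˡ : ∀ {a b c} → 0ℚ ≤ a → b ≤ c → a * b ≤ a * c
  *-monoˡ {a} 0≤a = ℚ.*-monoˡ-≤-nonNeg a {{ℚ.nonNegative 0≤a}}

  *-monoʳ : ∀ {a b c} → 0ℚ ≤ a → b ≤ c → b * a ≤ c * a
  *-monoʳ {a} 0≤a = ℚ.*-monoʳ-≤-nonNeg a {{ℚ.nonNegative 0≤a}}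

  0≤* : ∀ {a b} → 0ℚ ≤ a → 0ℚ ≤ b → 0ℚ ≤ a * b
  0≤* {a} {b} 0≤a 0≤b = subst (_≤ a * b) (ℚ.*-zeroʳ a) (*-monoˡ 0≤a 0≤b)

  0≤+ : ∀ {a b} → 0ℚ ≤ a → 0ℚ ≤ b → 0ℚ ≤ a + b
  0≤+ = ℚ.+-mono-≤

  *-mono : ∀ {a b c d} → 0ℚ ≤ a → 0ℚ ≤ b → a ≤ c → b ≤ d → a * b ≤ c * d
  *-mono 0≤a 0≤b a≤c b≤d = ℚ.≤-trans (*-monoʳ 0≤b a≤c) (*-monoˡ (ℚ.≤-trans 0≤a a≤c) b≤d)

  0≤^ : ∀ {a} n → 0ℚ ≤ a → 0ℚ ≤ a ^ n
  0≤^ zero    0≤a = ℕtoℚ-mono-≤ {0} {1} z≤n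
  0≤^ (suc n) 0≤a = 0≤* 0≤a (0≤^ n 0≤a)

  ^-mono : ∀ {a b} n → 0ℚ ≤ a → a ≤ b → a ^ n ≤ b ^ n
  ^-mono zero    0≤a a≤b = ℚ.≤-refl
  ^-mono (suc n) 0≤a a≤b = *-mono 0≤a (0≤^ n 0≤a) a≤b (^-mono n 0≤a a≤b)

  ^-monoʳ : ∀ {a m n} → 1ℚ ≤ a → m ℕ.≤ n → a ^ m ≤ a ^ n
  ^-monoʳ {n = zero}  1≤a z≤n = ℚ.≤-refl
  ^-monoʳ {a} {n = suc n} 1≤a z≤n = ℚ.≤-trans (^-monoʳ {n = n} 1≤a z≤n)
    (subst (_≤ a * a ^ n) (ℚ.*-identityˡ (a ^ n))
      (*-monoʳ (0≤^ n (ℚ.≤-trans (ℕtoℚ-mono-≤ {0} {1} z≤n) 1≤a)) 1≤a))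
  ^-monoʳ 1≤a (s≤s m≤n) = *-monoˡ (ℚ.≤-trans (ℕtoℚ-mono-≤ {0} {1} z≤n) 1≤a) (^-monoʳ 1≤a m≤n)

  p≤q⇒0≤q-p : ∀ {p q} → p ≤ q → 0ℚ ≤ q - p
  p≤q⇒0≤q-p {p} {q} p≤q = subst (_≤ q - p) (ℚ.+-inverseʳ p) (ℚ.+-monoˡ-≤ (- p) p≤q)

  0≤q-p⇒p≤q : ∀ {p q} → 0ℚ ≤ q - p → p ≤ q
  0≤q-p⇒p≤q {p} {q} 0≤ = subst₂ _≤_ (ℚ.+-identityˡ p)
    (solve 2 (λ p q → q :- p :+ p := q) refl p q) (ℚ.+-monoˡ-≤ p 0≤)

  square-cancel-≤ : ∀ {a b} → 0ℚ ≤ b → a * a ≤ b * b → a ≤ b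
  square-cancel-≤ {a} {b} 0≤b a²≤b² = ℚ.≮⇒≥ λ b<a → ℚ.<-irrefl refl (ℚ.<-≤-trans
    (ℚ.≤-<-trans (*-monoˡ 0≤b (ℚ.<⇒≤ b<a))
      (ℚ.*-monoˡ-<-pos a {{ℚ.positive (ℚ.≤-<-trans 0≤b b<a)}} b<a))
    a²≤b²)

-- Partial sums of the exponential series.

module Exponential where
  open import Data.Rational.Base using (_+_; _*_; _-_; _≤_)
  open +-*-Solver
  open OrderedField

  -- The Cauchy product, that is, the sum of `a i * b j` over `i + j = n`.
  conv : (ℕ → ℚ) → (ℕ → ℚ) → ℕ → ℚ
  conv a b zero    = a 0 * b 0
  conv a b (suc n) = a 0 * b (suc n) + conv (a ∘ suc) b n

  conv-last : ∀ a b n → conv a b (suc n) ≡ conv a (b ∘ suc) n + a (suc n) * b 0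
  conv-last a b zero    = refl
  conv-last a b (suc n) = trans (cong (a 0 * b (suc (suc n)) +_) (conv-last (a ∘ suc) b n))
    (sym (ℚ.+-assoc (a 0 * b (suc (suc n))) (conv (a ∘ suc) (b ∘ suc) n) (a (suc (suc n)) * b 0)))

  conv-scaleˡ : ∀ c {a} a′ b n → (∀ i → a i ≡ c * a′ i) → conv a b n ≡ c * conv a′ b n
  conv-scaleˡ c a′ b zero a≡ = trans (cong (_* b 0) (a≡ 0)) (ℚ.*-assoc c (a′ 0) (b 0))
  conv-scaleˡ c a′ b (suc n) a≡ = trans
    (cong₂ _+_ (trans (cong (_* b (suc n)) (a≡ 0)) (ℚ.*-assoc c (a′ 0) (b (suc n))))
      (conv-scaleˡ c (a′ ∘ suc) b n (a≡ ∘ suc)))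
    (sym (ℚ.*-distribˡ-+ c (a′ 0 * b (suc n)) (conv (a′ ∘ suc) b n)))

  conv-scaleʳ : ∀ c a {b} b′ n → (∀ i → b i ≡ c * b′ i) → conv a b n ≡ c * conv a b′ n
  conv-scaleʳ c a {b} b′ n b≡ = go a n
    where
    swap : ∀ x i → x * b i ≡ c * (x * b′ i)
    swap x i = trans (cong (x *_) (b≡ i))
      (solve 3 (λ x c b → x :* (c :* b) := c :* (x :* b)) refl x c (b′ i))
    go : ∀ a n → conv a b n ≡ c * conv a b′ n
    go a zero    = swap (a 0) 0
    go a (suc n) = trans (cong₂ _+_ (swap (a 0) (suc n)) (go (a ∘ suc) n))
      (sym (ℚ.*-distribˡ-+ c (a 0 * b′ (suc n)) (conv (a ∘ suc) b′ n)))

  -- The Leibniz rule, with weights α and β that need only add up to γ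
  -- on each antidiagonal so that the induction can shift α.
  conv-leibniz : ∀ {γ} (α β a b : ℕ → ℚ) n → (∀ i j → i ℕ.+ j ≡ n → α i + β j ≡ γ) →
    conv (λ i → α i * a i) b n + conv a (λ j → β j * b j) n ≡ γ * conv a b n
  conv-leibniz α β a b zero α+β = trans
    (solve 4 (λ x y a b → x :* a :* b :+ a :* (y :* b) := (x :+ y) :* (a :* b)) refl (α 0) (β 0) (a 0) (b 0))
    (cong (_* (a 0 * b 0)) (α+β 0 0 refl))
  conv-leibniz {γ} α β a b (suc n) α+β = begin
    α 0 * a 0 * b (suc n) + A + (a 0 * (β (suc n) * b (suc n)) + B)
      ≡⟨ solve 6 (λ x y a b A B → x :* a :* b :+ A :+ (a :* (y :* b) :+ B) := (x :+ y) :* (a :* b) :+ (A :+ B))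
           refl (α 0) (β (suc n)) (a 0) (b (suc n)) A B ⟩
    (α 0 + β (suc n)) * (a 0 * b (suc n)) + (A + B)
      ≡⟨ cong₂ _+_ (cong (_* (a 0 * b (suc n))) (α+β 0 (suc n) refl))
           (conv-leibniz (α ∘ suc) β (a ∘ suc) b n λ i j eq → α+β (suc i) j (cong suc eq)) ⟩
    γ * (a 0 * b (suc n)) + γ * conv (a ∘ suc) b n
      ≡⟨ ℚ.*-distribˡ-+ γ (a 0 * b (suc n)) (conv (a ∘ suc) b n) ⟨
    γ * conv a b (suc n) ∎
    where
    open ≡-Reasoning
    A = conv (λ i → α (suc i) * a (suc i)) b n
    B = conv (a ∘ suc) (λ j → β j * b j) n

  expTerm-derivative : ∀ x j → ℕtoℚ (suc j) * expTerm x (suc j) ≡ x * expTerm x j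
  expTerm-derivative x j = trans
    (solve 4 (λ n t x u → n :* (t :* (x :* u)) := n :* u :* (x :* t)) refl
      (ℕtoℚ (suc j)) (expTerm x j) x (ℤ.+ 1 / suc j))
    (trans (cong (_* (x * expTerm x j)) (ℕtoℚ-*-inverse (suc j))) (ℚ.*-identityˡ _))

  -- The product of the power series of exp(xt) and exp(yt) solves f′ = (x + y)f; this is the
  -- equation at the coefficient of tⁿ. The recurrence determines the coefficients and so replaces
  -- the binomial theorem in `expTerm-+`.
  conv-expTerm-derivative : ∀ x y n → let c = conv (expTerm x) (expTerm y) in
    ℕtoℚ (suc n) * c (suc n) ≡ (x + y) * c n
  conv-expTerm-derivative x y n = begin
    ℕtoℚ (suc n) * conv s t (suc n)
      ≡⟨ conv-leibniz ℕtoℚ ℕtoℚ s t (suc n) (λ i j eq → trans (sym (ℕtoℚ-homo-+ i j)) (cong ℕtoℚ eq)) ⟨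
    (0ℚ * s 0 * t (suc n) + conv (∂ s ∘ suc) t n) + conv s (∂ t) (suc n)
      ≡⟨ cong₂ _+_ (cong (0ℚ * s 0 * t (suc n) +_) (conv-scaleˡ x s t n (expTerm-derivative x)))
           (trans (conv-last s (∂ t) n) (cong (_+ s (suc n) * (0ℚ * t 0)) (conv-scaleʳ y s t n (expTerm-derivative y)))) ⟩
    (0ℚ * s 0 * t (suc n) + x * c) + (y * c + s (suc n) * (0ℚ * t 0))
      ≡⟨ solve 7 (λ a b d e x y c → (con 0ℚ :* a :* b :+ x :* c) :+ (y :* c :+ d :* (con 0ℚ :* e)) := (x :+ y) :* c)
           refl (s 0) (t (suc n)) (s (suc n)) (t 0) x y c ⟩
    (x + y) * c ∎
    where
    open ≡-Reasoning
    s = expTerm x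
    t = expTerm y
    c = conv s t n
    ∂ : (ℕ → ℚ) → ℕ → ℚ
    ∂ a i = ℕtoℚ i * a i

  expTerm-+ : ∀ x y n → expTerm (x + y) n ≡ conv (expTerm x) (expTerm y) n
  expTerm-+ x y zero    = refl
  expTerm-+ x y (suc n) = begin
    expTerm (x + y) n * ((x + y) * u)  ≡⟨ cong (_* ((x + y) * u)) (expTerm-+ x y n) ⟩
    c n * ((x + y) * u)                ≡⟨ solve 3 (λ c z u → c :* (z :* u) := u :* (z :* c)) refl (c n) (x + y) u ⟩
    u * ((x + y) * c n)                ≡⟨ cong (u *_) (conv-expTerm-derivative x y n) ⟨
    u * (ℕtoℚ (suc n) * c (suc n))     ≡⟨ solve 3 (λ u n c → u :* (n :* c) := n :* u :* c) refl u (ℕtoℚ (suc n)) (c (suc n)) ⟩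
    ℕtoℚ (suc n) * u * c (suc n)       ≡⟨ cong (_* c (suc n)) (ℕtoℚ-*-inverse (suc n)) ⟩
    1ℚ * c (suc n)                     ≡⟨ ℚ.*-identityˡ _ ⟩
    c (suc n)                          ∎
    where
    open ≡-Reasoning
    u = ℤ.+ 1 / suc n
    c = conv (expTerm x) (expTerm y)

  partialSum : (ℕ → ℚ) → ℕ → ℚ
  partialSum a zero    = 0ℚ
  partialSum a (suc n) = a 0 + partialSum (a ∘ suc) n

  partialSum-last : ∀ a n → partialSum a (suc n) ≡ partialSum a n + a n
  partialSum-last a zero    = ℚ.+-comm (a 0) 0ℚ
  partialSum-last a (suc n) = trans (cong (a 0 +_) (partialSum-last (a ∘ suc) n))
    (sym (ℚ.+-assoc (a 0) (partialSum (a ∘ suc) n) (a (suc n))))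

  expSum≡partialSum : ∀ x n → expSum x n ≡ partialSum (expTerm x) n
  expSum≡partialSum x zero    = refl
  expSum≡partialSum x (suc n) = trans (cong (_+ expTerm x n) (expSum≡partialSum x n))
    (sym (partialSum-last (expTerm x) n))

  -- The sum of `a i * expTerm y j` over the triangle `i + j < n`, taken row by row;
  -- `triangleSum-last` adds an antidiagonal instead.
  triangleSum : (ℕ → ℚ) → ℚ → ℕ → ℚ
  triangleSum a y zero    = 0ℚ
  triangleSum a y (suc n) = a 0 * expSum y (suc n) + triangleSum (a ∘ suc) y n

  triangleSum-last : ∀ a y n → triangleSum a y (suc n) ≡ triangleSum a y n + conv a (expTerm y) n
  triangleSum-last a y zero    =
    solve 1 (λ a → a :* (con 0ℚ :+ con 1ℚ) :+ con 0ℚ := con 0ℚ :+ a :* con 1ℚ) refl (a 0)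
  triangleSum-last a y (suc n) = trans
    (cong (a 0 * expSum y (suc (suc n)) +_) (triangleSum-last (a ∘ suc) y n))
    (solve 5 (λ a E t S c → a :* (E :+ t) :+ (S :+ c) := a :* E :+ S :+ (a :* t :+ c)) refl
      (a 0) (expSum y (suc n)) (expTerm y (suc n)) (triangleSum (a ∘ suc) y n) (conv (a ∘ suc) (expTerm y) n))

  expSum-+ : ∀ x y n → expSum (x + y) n ≡ triangleSum (expTerm x) y n
  expSum-+ x y zero    = refl
  expSum-+ x y (suc n) = trans (cong₂ _+_ (expSum-+ x y n) (expTerm-+ x y n))
    (sym (triangleSum-last (expTerm x) y n))

  0≤expTerm : ∀ {x} → 0ℚ ≤ x → ∀ n → 0ℚ ≤ expTerm x n
  0≤expTerm 0≤x zero    = 0≤ℕtoℚ 1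
  0≤expTerm 0≤x (suc n) = 0≤* (0≤expTerm 0≤x n) (0≤* 0≤x (0≤1/n (suc n)))

  0≤expSum : ∀ {x} → 0ℚ ≤ x → ∀ n → 0ℚ ≤ expSum x n
  0≤expSum 0≤x zero    = ℚ.≤-refl
  0≤expSum 0≤x (suc n) = 0≤+ (0≤expSum 0≤x n) (0≤expTerm 0≤x n)

  expSum-monoʳ : ∀ {x} → 0ℚ ≤ x → ∀ {m n} → m ℕ.≤ n → expSum x m ≤ expSum x n
  expSum-monoʳ {x} 0≤x = go ∘ ℕ.≤⇒≤′
    where
    go : ∀ {m n} → m ℕ.≤′ n → expSum x m ≤ expSum x n
    go ℕ.≤′-refl            = ℚ.≤-refl
    go (ℕ.≤′-step {n} m≤n) = ℚ.≤-trans (go m≤n)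
      (subst (_≤ expSum x (suc n)) (ℚ.+-identityʳ _) (ℚ.+-monoʳ-≤ (expSum x n) (0≤expTerm 0≤x n)))

  expTerm-mono : ∀ {x y} → 0ℚ ≤ x → x ≤ y → ∀ n → expTerm x n ≤ expTerm y n
  expTerm-mono 0≤x x≤y zero    = ℚ.≤-refl
  expTerm-mono 0≤x x≤y (suc n) = *-mono (0≤expTerm 0≤x n) (0≤* 0≤x (0≤1/n (suc n)))
    (expTerm-mono 0≤x x≤y n) (*-monoʳ (0≤1/n (suc n)) x≤y)

  expSum-mono : ∀ {x y} → 0ℚ ≤ x → x ≤ y → ∀ n → expSum x n ≤ expSum y n
  expSum-mono 0≤x x≤y zero    = ℚ.≤-refl
  expSum-mono 0≤x x≤y (suc n) = ℚ.+-mono-≤ (expSum-mono 0≤x x≤y n) (expTerm-mono 0≤x x≤y n)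

  -- The triangle `i + j < n` lies in the square `i , j < n`, and all terms are nonnegative.
  expSum-+-≤ : ∀ {x y} → 0ℚ ≤ x → 0ℚ ≤ y → ∀ n → expSum (x + y) n ≤ expSum x n * expSum y n
  expSum-+-≤ {x} {y} 0≤x 0≤y n = subst₂ _≤_ (sym (expSum-+ x y n))
    (cong (_* expSum y n) (sym (expSum≡partialSum x n))) (go (expTerm x) (0≤expTerm 0≤x) n ℕ.≤-refl)
    where
    go : ∀ a → (∀ i → 0ℚ ≤ a i) → ∀ k → k ℕ.≤ n → triangleSum a y k ≤ partialSum a k * expSum y n
    go a 0≤a zero    _   = ℚ.≤-reflexive (sym (ℚ.*-zeroˡ (expSum y n)))
    go a 0≤a (suc k) k<n = subst (triangleSum a y (suc k) ≤_) (sym (ℚ.*-distribʳ-+ (expSum y n) (a 0) (partialSum (a ∘ suc) k)))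
      (ℚ.+-mono-≤ (*-monoˡ (0≤a 0) (expSum-monoʳ 0≤y k<n))
        (go (a ∘ suc) (0≤a ∘ suc) k (ℕ.<⇒≤ k<n)))

  -- The rectangle `i < m`, `j < n` lies in the triangle `i + j < m + n`, and all terms are
  -- nonnegative.
  expSum-+-≥ : ∀ {x y} → 0ℚ ≤ x → 0ℚ ≤ y → ∀ m n → expSum x m * expSum y n ≤ expSum (x + y) (m ℕ.+ n)
  expSum-+-≥ {x} {y} 0≤x 0≤y m n = subst₂ _≤_ (cong (_* expSum y n) (sym (expSum≡partialSum x m)))
    (sym (expSum-+ x y (m ℕ.+ n))) (go (expTerm x) (0≤expTerm 0≤x) m)
    where
    0≤triangleSum : ∀ a → (∀ i → 0ℚ ≤ a i) → ∀ k → 0ℚ ≤ triangleSum a y k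
    0≤triangleSum a 0≤a zero    = ℚ.≤-refl
    0≤triangleSum a 0≤a (suc k) = 0≤+ (0≤* (0≤a 0) (0≤expSum 0≤y (suc k))) (0≤triangleSum (a ∘ suc) (0≤a ∘ suc) k)
    go : ∀ a → (∀ i → 0ℚ ≤ a i) → ∀ k → partialSum a k * expSum y n ≤ triangleSum a y (k ℕ.+ n)
    go a 0≤a zero    = subst (_≤ triangleSum a y n) (sym (ℚ.*-zeroˡ (expSum y n))) (0≤triangleSum a 0≤a n)
    go a 0≤a (suc k) = subst (_≤ triangleSum a y (suc (k ℕ.+ n))) (sym (ℚ.*-distribʳ-+ (expSum y n) (a 0) (partialSum (a ∘ suc) k)))
      (ℚ.+-mono-≤ (*-monoˡ (0≤a 0) (expSum-monoʳ 0≤y (ℕ.m≤n+m n (suc k))))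
        (go (a ∘ suc) (0≤a ∘ suc) k))

  expSum-^ : ∀ {x} → 0ℚ ≤ x → ∀ n k → expSum (ℕtoℚ k * x) n ≤ expSum x n ^ k
  expSum-^ {x} 0≤x n zero = subst (λ z → expSum z n ≤ 1ℚ) (sym (ℚ.*-zeroˡ x)) (go n)
    where
    expTerm-0 : ∀ j → expTerm 0ℚ (suc j) ≡ 0ℚ
    expTerm-0 j = solve 2 (λ t u → t :* (con 0ℚ :* u) := con 0ℚ) refl (expTerm 0ℚ j) (ℤ.+ 1 / suc j)
    go : ∀ n → expSum 0ℚ n ≤ 1ℚ
    go zero          = 0≤ℕtoℚ 1
    go (suc zero)    = ℚ.≤-refl
    go (suc (suc n)) = subst (_≤ 1ℚ) (sym (trans (cong (expSum 0ℚ (suc n) +_) (expTerm-0 n)) (ℚ.+-identityʳ _))) (go (suc n))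
  expSum-^ {x} 0≤x n (suc k) = begin
    expSum (ℕtoℚ (suc k) * x) n        ≡⟨ cong (λ z → expSum (z * x) n) (ℕtoℚ-homo-+ 1 k) ⟩
    expSum ((1ℚ + ℕtoℚ k) * x) n       ≡⟨ cong (λ z → expSum z n) (solve 2 (λ k x → (con 1ℚ :+ k) :* x := x :+ k :* x) refl (ℕtoℚ k) x) ⟩
    expSum (x + ℕtoℚ k * x) n          ≤⟨ expSum-+-≤ 0≤x (0≤* (0≤ℕtoℚ k) 0≤x) n ⟩
    expSum x n * expSum (ℕtoℚ k * x) n ≤⟨ *-monoˡ (0≤expSum 0≤x n) (expSum-^ 0≤x n k) ⟩
    expSum x n * expSum x n ^ k        ∎
    where open ℚ.≤-Reasoning

  -- Since `1 + y` is the partial sum `expSum y 2`, a power of it can be absorbed into the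
  -- exponential without a limit; each factor raises the truncation index by two.
  expSum-*-[1+y]^k : ∀ {x y} → 0ℚ ≤ x → 0ℚ ≤ y → ∀ n k →
    expSum x n * (1ℚ + y) ^ k ≤ expSum (x + ℕtoℚ k * y) (k ℕ.* 2 ℕ.+ n)
  expSum-*-[1+y]^k {x} {y} 0≤x 0≤y n zero = ℚ.≤-reflexive (trans (ℚ.*-identityʳ _)
    (cong (λ z → expSum z n) (solve 2 (λ x y → x := x :+ con 0ℚ :* y) refl x y)))
  expSum-*-[1+y]^k {x} {y} 0≤x 0≤y n (suc k) = begin
    expSum x n * ((1ℚ + y) * (1ℚ + y) ^ k)
      ≡⟨ solve 3 (λ E z p → E :* ((con 1ℚ :+ z) :* p) := (con 0ℚ :+ con 1ℚ :+ con 1ℚ :* (z :* con 1ℚ)) :* (E :* p))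
           refl (expSum x n) y ((1ℚ + y) ^ k) ⟩
    expSum y 2 * (expSum x n * (1ℚ + y) ^ k)
      ≤⟨ *-monoˡ (0≤expSum 0≤y 2) (expSum-*-[1+y]^k 0≤x 0≤y n k) ⟩
    expSum y 2 * expSum (x + ℕtoℚ k * y) (k ℕ.* 2 ℕ.+ n)
      ≤⟨ expSum-+-≥ 0≤y (0≤+ 0≤x (0≤* (0≤ℕtoℚ k) 0≤y)) 2 (k ℕ.* 2 ℕ.+ n) ⟩
    expSum (y + (x + ℕtoℚ k * y)) (suc k ℕ.* 2 ℕ.+ n)
      ≡⟨ cong (λ z → expSum z (suc k ℕ.* 2 ℕ.+ n))
           (trans (solve 3 (λ x y k → y :+ (x :+ k :* y) := x :+ (con 1ℚ :+ k) :* y) refl x y (ℕtoℚ k))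
             (cong (λ z → x + z * y) (sym (ℕtoℚ-homo-+ 1 k)))) ⟩
    expSum (x + ℕtoℚ (suc k) * y) (suc k ℕ.* 2 ℕ.+ n) ∎
    where open ℚ.≤-Reasoning

  1/n≤1 : ∀ n .{{_ : ℕ.NonZero n}} → ℤ.+ 1 / n ≤ 1ℚ
  1/n≤1 n@(suc m) = begin
    u             ≡⟨ ℚ.*-identityˡ u ⟨
    1ℚ * u        ≤⟨ *-monoʳ (0≤1/n n) (ℕtoℚ-mono-≤ {1} {n} (s≤s z≤n)) ⟩
    ℕtoℚ n * u    ≡⟨ ℕtoℚ-*-inverse n ⟩
    1ℚ            ∎
    where
    open ℚ.≤-Reasoning
    u = ℤ.+ 1 / n

  -- eʸ ≤ 1/(1 − y), with b standing for 1/(1 − y).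
  expSum-geometric : ∀ {y b} → 0ℚ ≤ y → 0ℚ ≤ b → b * y ≡ b - 1ℚ → ∀ n → expSum y n ≤ b
  expSum-geometric {y} {b} 0≤y 0≤b by≡b-1 n = ℚ.≤-trans
    (subst (_≤ expSum y n + b * expTerm y n) (ℚ.+-identityʳ _)
      (ℚ.+-monoʳ-≤ (expSum y n) (0≤* 0≤b (0≤expTerm 0≤y n))))
    (go n)
    where
    -- The added term dominates the remainder: from index n on, the terms are at most `expTerm y n`
    -- times 1, y, y², ..., which sum to b.
    go : ∀ n → expSum y n + b * expTerm y n ≤ b
    go zero    = ℚ.≤-reflexive (solve 1 (λ b → con 0ℚ :+ b :* con 1ℚ := b) refl b)
    go (suc n) = begin
      E + t + b * (t * (y * u))       ≤⟨ ℚ.+-monoʳ-≤ (E + t) (*-monoˡ 0≤b (*-monoˡ (0≤expTerm 0≤y n) (*-monoˡ 0≤y (1/n≤1 (suc n))))) ⟩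
      E + t + b * (t * (y * 1ℚ))      ≡⟨ solve 4 (λ E t b y → E :+ t :+ b :* (t :* (y :* con 1ℚ)) := E :+ t :+ b :* y :* t) refl E t b y ⟩
      E + t + b * y * t               ≡⟨ cong (λ z → E + t + z * t) by≡b-1 ⟩
      E + t + (b - 1ℚ) * t            ≡⟨ solve 3 (λ E t b → E :+ t :+ (b :- con 1ℚ) :* t := E :+ b :* t) refl E t b ⟩
      E + b * t                       ≤⟨ go n ⟩
      b                               ∎
      where
      open ℚ.≤-Reasoning
      E = expSum y n
      t = expTerm y n
      u = ℤ.+ 1 / suc n

  -- With the tilt β = 1 + δ, the bound log(1 + δ) ≥ δ/(1 + δ) is just
  -- enough: dδ²/4 + dδ²/2(1+δ) ≤ dδ²/(1+δ) because δ ≤ 1.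
  expSum⁴*cosh^d≤β^D : ∀ d D {β r δ x} → 0ℚ ≤ δ → δ ≤ 1ℚ → β ≡ 1ℚ + δ → 0ℚ ≤ r → β * r ≡ 1ℚ →
    ℕtoℚ d * δ ≡ ℕtoℚ D → 0ℚ ≤ x → (x + x) + (x + x) ≡ ½ * ½ * (ℕtoℚ D * δ) →
    ∀ n → (expSum x n * expSum x n) * (expSum x n * expSum x n) * (½ * (β + r)) ^ d ≤ β ^ D
  expSum⁴*cosh^d≤β^D d D {β} {r} {δ} {x} 0≤δ δ≤1 refl 0≤r βr≡1 dδ≡D 0≤x 4x≡ n = begin
    (E * E) * (E * E) * (½ * (β + r)) ^ d
      ≤⟨ *-monoʳ (0≤^ d 0≤cosh) (ℚ.≤-trans (*-mono (0≤* 0≤E 0≤E) (0≤* 0≤E 0≤E) E²≤ E²≤)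
           (expSum-+-≥ 0≤2x 0≤2x (n ℕ.+ n) (n ℕ.+ n))) ⟩
    expSum z N * (½ * (β + r)) ^ d
      ≡⟨ cong (λ c → expSum z N * c ^ d) cosh≡ ⟩
    expSum z N * (1ℚ + w) ^ d
      ≤⟨ expSum-*-[1+y]^k 0≤z 0≤w N d ⟩
    expSum (z + ℕtoℚ d * w) M
      ≤⟨ expSum-mono (0≤+ 0≤z (0≤* (0≤ℕtoℚ d) 0≤w)) exponent≤ M ⟩
    expSum (ℕtoℚ D * y) M
      ≤⟨ expSum-^ 0≤y M D ⟩
    expSum y M ^ D
      ≤⟨ ^-mono D (0≤expSum 0≤y M) (expSum-geometric 0≤y 0≤β βy≡β-1 M) ⟩
    β ^ D ∎
    where
    open ℚ.≤-Reasoning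
    E = expSum x n
    -- `y` is `1 - 1/β`, so that `β = 1/(1 - y)` dominates exp y; `w` is the excess δ²/2(1 + δ) of
    -- cosh(log β) over 1, and `z` is the exponent 4x of the fourth power.
    y = δ * r
    w = ½ * (δ * y)
    z = (x + x) + (x + x)
    N = n ℕ.+ n ℕ.+ (n ℕ.+ n)
    M = d ℕ.* 2 ℕ.+ N
    0≤β : 0ℚ ≤ β
    0≤β = 0≤+ (0≤ℕtoℚ 1) 0≤δ
    0≤cosh : 0ℚ ≤ ½ * (β + r)
    0≤cosh = 0≤* 0≤½ (0≤+ 0≤β 0≤r)
    0≤y : 0ℚ ≤ y
    0≤y = 0≤* 0≤δ 0≤r
    0≤w : 0ℚ ≤ w
    0≤w = 0≤* 0≤½ (0≤* 0≤δ 0≤y)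
    0≤2x : 0ℚ ≤ x + x
    0≤2x = 0≤+ 0≤x 0≤x
    0≤z : 0ℚ ≤ z
    0≤z = 0≤+ 0≤2x 0≤2x
    0≤E : 0ℚ ≤ E
    0≤E = 0≤expSum 0≤x n
    E²≤ : E * E ≤ expSum (x + x) (n ℕ.+ n)
    E²≤ = expSum-+-≥ 0≤x 0≤x n n
    βy≡β-1 : β * y ≡ β - 1ℚ
    βy≡β-1 = trans (solve 2 (λ δ r → (con 1ℚ :+ δ) :* (δ :* r) := δ :* ((con 1ℚ :+ δ) :* r)) refl δ r)
      (trans (cong (δ *_) βr≡1) (solve 1 (λ δ → δ :* con 1ℚ := con 1ℚ :+ δ :- con 1ℚ) refl δ))
    cosh≡ : ½ * (β + r) ≡ 1ℚ + w
    cosh≡ = trans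
      (solve 2 (λ δ r → con ½ :* (con 1ℚ :+ δ :+ r) :=
          con ½ :* ((con 1ℚ :+ δ) :* con 1ℚ :+ r)) refl δ r)
      (trans (solve 2 (λ δ r → con ½ :* ((con 1ℚ :+ δ) :* con 1ℚ :+ r) :=
          con 1ℚ :+ con ½ :* (δ :* con 1ℚ :- con 1ℚ :+ r)) refl δ r)
      -- Replacing two of the 1s by `β * r` leaves a polynomial identity in `δ` and `r`.
      (trans (cong (λ e → 1ℚ + ½ * (δ * e - e + r)) (sym βr≡1))
        (solve 2 (λ δ r → let e = (con 1ℚ :+ δ) :* r in
          con 1ℚ :+ con ½ :* (δ :* e :- e :+ r) := con 1ℚ :+ con ½ :* (δ :* (δ :* r))) refl δ r)))
    -- This is where `δ ≤ 1` enters: it lets the term Dδ/4 be charged against half of Dδ/(1 + δ).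
    ½≤r : ½ ≤ r
    ½≤r = begin
      ½ * 1ℚ                ≡⟨ cong (½ *_) βr≡1 ⟨
      ½ * ((1ℚ + δ) * r)    ≤⟨ *-monoˡ 0≤½ (*-monoʳ 0≤r (ℚ.+-monoʳ-≤ 1ℚ δ≤1)) ⟩
      ½ * ((1ℚ + 1ℚ) * r)   ≡⟨ solve 1 (λ r → con ½ :* ((con 1ℚ :+ con 1ℚ) :* r) := r) refl r ⟩
      r                     ∎
    exponent≤ : z + ℕtoℚ d * w ≤ ℕtoℚ D * y
    exponent≤ = begin
      z + ℕtoℚ d * w
        ≡⟨ cong₂ _+_ 4x≡ (trans (solve 4 (λ d δ r h → d :* (h :* (δ :* (δ :* r))) := h :* (d :* δ :* (δ :* r))) refl (ℕtoℚ d) δ r ½)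
             (cong (λ e → ½ * (e * y)) dδ≡D)) ⟩
      ½ * ½ * (ℕtoℚ D * δ) + ½ * (ℕtoℚ D * y)
        ≡⟨ solve 3 (λ D δ y → con ½ :* con ½ :* (D :* δ) :+ con ½ :* (D :* y) :=
             con ½ :* (D :* δ :* con ½) :+ con ½ :* (D :* y)) refl (ℕtoℚ D) δ y ⟩
      ½ * (ℕtoℚ D * δ * ½) + ½ * (ℕtoℚ D * y)
        ≤⟨ ℚ.+-monoˡ-≤ (½ * (ℕtoℚ D * y)) (*-monoˡ 0≤½ (*-monoˡ (0≤* (0≤ℕtoℚ D) 0≤δ) ½≤r)) ⟩
      ½ * (ℕtoℚ D * δ * r) + ½ * (ℕtoℚ D * y)
        ≡⟨ solve 3 (λ D δ r → con ½ :* (D :* δ :* r) :+ con ½ :* (D :* (δ :* r)) := D :* (δ :* r)) refl (ℕtoℚ D) δ r ⟩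
      ℕtoℚ D * y ∎

-- Sums over finite sets and over their products.

module Summation where
  open import Data.Rational.Base using (_+_; _*_; _≤_)
  open import Algebra.Properties.Semiring.Sum (CommutativeRing.semiring ℚ.+-*-commutativeRing)
    using (sum; sum-cong-≗; ∑-comm; sum-permute; ∑-distrib-+; *-distribˡ-sum; *-distribʳ-sum)
  open OrderedField

  infixr 5 ∑
  ∑ : (X : FiniteSet) → (Carrier X → ℚ) → ℚ
  ∑ X f = sum (f ∘ Inverse.from (FiniteSet.enum X))

  syntax ∑ X (λ x → e) = ∑[ x ∈ X ] e

  ∑-cong : ∀ X {f g} → (∀ x → f x ≡ g x) → ∑ X f ≡ ∑ X g
  ∑-cong X f≗g = sum-cong-≗ λ i → f≗g (Inverse.from (FiniteSet.enum X) i)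

  ∑-+ : ∀ X f g → ∑[ x ∈ X ] (f x + g x) ≡ ∑ X f + ∑ X g
  ∑-+ X f g = ∑-distrib-+ (f ∘ Inverse.from (FiniteSet.enum X)) (g ∘ Inverse.from (FiniteSet.enum X))

  ∑-*ˡ : ∀ X c f → ∑[ x ∈ X ] (c * f x) ≡ c * ∑ X f
  ∑-*ˡ X c f = sym (*-distribˡ-sum c (f ∘ Inverse.from (FiniteSet.enum X)))

  ∑-*ʳ : ∀ X c f → ∑[ x ∈ X ] (f x * c) ≡ ∑ X f * c
  ∑-*ʳ X c f = sym (*-distribʳ-sum c (f ∘ Inverse.from (FiniteSet.enum X)))

  ∑-swap : ∀ X Y (f : Carrier X → Carrier Y → ℚ) →
    ∑[ x ∈ X ] ∑[ y ∈ Y ] f x y ≡ ∑[ y ∈ Y ] ∑[ x ∈ X ] f x y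
  ∑-swap X Y f = ∑-comm λ i j → f (Inverse.from (FiniteSet.enum X) i) (Inverse.from (FiniteSet.enum Y) j)

  ∑-mono : ∀ X {f g} → (∀ x → f x ≤ g x) → ∑ X f ≤ ∑ X g
  ∑-mono X {f} {g} f≤g = go (size X) (λ i → f≤g (Inverse.from (FiniteSet.enum X) i))
    where
    go : ∀ n {f g : Fin n → ℚ} → (∀ i → f i ≤ g i) → sum f ≤ sum g
    go zero    f≤g = ℚ.≤-refl
    go (suc n) f≤g = ℚ.+-mono-≤ (f≤g zero) (go n (f≤g ∘ suc))

  ∑-⊗ : ∀ X Y f g → ∑[ x ∈ X ] ∑[ y ∈ Y ] (f x * g y) ≡ ∑ X f * ∑ Y g
  ∑-⊗ X Y f g = trans (∑-cong X λ x → ∑-*ˡ Y (f x) g) (∑-*ʳ X (∑ Y g) f)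

  sum-splitAt : ∀ m n (f : Fin (m ℕ.+ n) → ℚ) → sum f ≡ sum (λ i → f (i ↑ˡ n)) + sum (λ j → f (m ↑ʳ j))
  sum-splitAt zero    n f = sym (ℚ.+-identityˡ _)
  sum-splitAt (suc m) n f = trans (cong (f zero +_) (sum-splitAt m n (f ∘ suc)))
    (sym (ℚ.+-assoc (f zero) (sum (λ i → f (suc (i ↑ˡ n)))) (sum (λ j → f (suc (m ↑ʳ j))))))

  sum-combine : ∀ m n (f : Fin (m ℕ.* n) → ℚ) → sum f ≡ sum (λ (i : Fin m) → sum (λ j → f (combine i j)))
  sum-combine zero    n f = refl
  sum-combine (suc m) n f = trans (sum-splitAt n (m ℕ.* n) f)
    (cong (sum (λ j → f (j ↑ˡ (m ℕ.* n))) +_) (sum-combine m n (λ k → f (n ↑ʳ k))))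

  -- The enumeration of Ω (X ∷ H) does not unfold to that of Ω H: the local
  -- functions of Ω also take the whole vector as a parameter.
  sum-reindex : ∀ {A : Set} {m n} (e₁ : A ↔ Fin m) (e₂ : A ↔ Fin n) (f : A → ℚ) →
    sum (f ∘ Inverse.from e₁) ≡ sum (f ∘ Inverse.from e₂)
  sum-reindex e₁ e₂ f = trans (sum-permute (f ∘ Inverse.from e₁) (↔-trans (↔-sym e₂) e₁))
    (sum-cong-≗ λ i → cong f (Inverse.strictlyInverseʳ e₁ (Inverse.from e₂ i)))

  ∑-Ω : ∀ {d} X (H : Vec FiniteSet d) f → ∑ (Ω (X ∷ H)) f ≡ ∑[ x ∈ X ] ∑[ u ∈ Ω H ] f (x , u)
  ∑-Ω X H f = trans
    (sum-reindex (FiniteSet.enum (Ω (X ∷ H)))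
      (↔-trans (FiniteSet.enum X ×-↔ FiniteSet.enum (Ω H)) (↔-sym Fin.*↔×)) f)
    (trans (sum-combine (size X) (size (Ω H)) (g ∘ remQuot (size (Ω H))))
      (sum-cong-≗ λ i → sum-cong-≗ λ j → cong g (Fin.remQuot-combine i j)))
    where
    g : Fin (size X) × Fin (size (Ω H)) → ℚ
    g (i , j) = f (Inverse.from (FiniteSet.enum X) i , Inverse.from (FiniteSet.enum (Ω H)) j)

  indicator : {P : Set} → Dec P → ℕ
  indicator c = if does c then 1 else 0

  length-filter-∷ : ∀ {A : Set} {P : Pred A 0ℓ} (P? : Decidable P) x xs →
    length (filter P? (x List.∷ xs)) ≡ indicator (P? x) ℕ.+ length (filter P? xs)
  length-filter-∷ P? x xs with does (P? x)
  ... | true  = refl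
  ... | false = refl

  𝟙 : {P : Set} → Dec P → ℚ
  𝟙 c = ℕtoℚ (indicator c)

  0≤𝟙 : ∀ {P : Set} (c : Dec P) → 0ℚ ≤ 𝟙 c
  0≤𝟙 c = 0≤ℕtoℚ (indicator c)

  ∣∣≡∑𝟙 : ∀ {X} (S : Subset X) → ℕtoℚ ∣ S ∣ ≡ ∑[ x ∈ X ] 𝟙 (member? S x)
  ∣∣≡∑𝟙 {X} S = go (size X) (λ i → i)
    where
    g = Inverse.from (FiniteSet.enum X)
    go : ∀ n (h : Fin n → Fin (size X)) →
      ℕtoℚ (length (filter (member? S) (List.map g (tabulate h)))) ≡ sum (λ i → 𝟙 (member? S (g (h i))))
    go zero    h = refl
    go (suc n) h = trans (cong ℕtoℚ (length-filter-∷ (member? S) (g (h zero)) _))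
      (trans (ℕtoℚ-homo-+ (indicator (member? S (g (h zero)))) _)
        (cong (𝟙 (member? S (g (h zero))) +_) (go n (h ∘ suc))))

-- The distance, one coordinate at a time.

module Distance where
  open Summation using (indicator; length-filter-∷)

  length-filter-tabulate-suc : ∀ {m n} {P : Pred (Fin (suc m)) 0ℓ} (P? : Decidable P) (h : Fin n → Fin m) →
    length (filter P? (tabulate (suc ∘ h))) ≡ length (filter (P? ∘ suc) (tabulate h))
  length-filter-tabulate-suc {n = zero}  P? h = refl
  length-filter-tabulate-suc {n = suc n} P? h =
    trans (length-filter-∷ P? (suc (h zero)) _)
      (trans (cong (indicator (P? (suc (h zero))) ℕ.+_) (length-filter-tabulate-suc P? (h ∘ suc)))
        (sym (length-filter-∷ (P? ∘ suc) (h zero) _)))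

  module _ {d} (X : FiniteSet) (H : Vec FiniteSet d) where

    ℓ₀-∷ : ∀ x y u v → ℓ₀ (X ∷ H) (x , u) (y , v) ≡
      (if does (FiniteSet._≟_ X x y) then 0 else 1) ℕ.+ ℓ₀ H u v
    ℓ₀-∷ x y u v = trans (length-filter-∷ P? zero _)
      (cong₂ ℕ._+_ (go (FiniteSet._≟_ X x y)) (length-filter-tabulate-suc P? (λ i → i)))
      where
      P? : Decidable (λ i → ¬ (coord {H = X ∷ H} (x , u) i ≡ coord {H = X ∷ H} (y , v) i))
      P? i = ¬? (FiniteSet._≟_ (Vec.lookup (X ∷ H) i) (coord {H = X ∷ H} (x , u) i) (coord {H = X ∷ H} (y , v) i))
      go : (c : Dec (x ≡ y)) → indicator (¬? c) ≡ (if does c then 0 else 1)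
      go (yes _) = refl
      go (no _)  = refl

    ℓ₀-≡ : ∀ x u v → ℓ₀ (X ∷ H) (x , u) (x , v) ≡ ℓ₀ H u v
    ℓ₀-≡ x u v = trans (ℓ₀-∷ x x u v) (go (FiniteSet._≟_ X x x))
      where
      go : (c : Dec (x ≡ x)) → (if does c then 0 else 1) ℕ.+ ℓ₀ H u v ≡ ℓ₀ H u v
      go (yes _)  = refl
      go (no x≢x) = contradiction refl x≢x

    ℓ₀-≢ : ∀ {x y} u v → ¬ x ≡ y → ℓ₀ (X ∷ H) (x , u) (y , v) ≡ suc (ℓ₀ H u v)
    ℓ₀-≢ {x} {y} u v x≢y = trans (ℓ₀-∷ x y u v) (go (FiniteSet._≟_ X x y))
      where
      go : (c : Dec (x ≡ y)) → (if does c then 0 else 1) ℕ.+ ℓ₀ H u v ≡ suc (ℓ₀ H u v)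
      go (yes x≡y) = contradiction x≡y x≢y
      go (no _)    = refl

-- The random crossover: invariance of the total sum, and support.

module Crossover where
  open import Data.Rational.Base using (_+_; _*_; _≤_)
  open +-*-Solver
  open OrderedField
  open Summation
  open Distance

  Kernel : ∀ {d} → Vec FiniteSet d → Set
  Kernel H = Π H → Π H → ℚ

  slice : ∀ {A B C : Set} → (A × B → A × B → C) → A → A → B → B → C
  slice F x y u v = F (x , u) (y , v)

  -- Consecutive coordinates at which u and v differ are paired up, and for
  -- each pair a fair coin decides which one of the two is exchanged between
  -- u and v; `crossover F u v` is the expectation of F at the resulting
  -- pair of points. In `pending b` one coordinate of a pair has been
  -- treated, and b tells whether the other one has to be exchanged.
  mutual
    crossover : ∀ {d} (H : Vec FiniteSet d) → Kernel H → Kernel H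
    crossover []      F u v = F u v
    crossover (X ∷ H) F (x , u) (y , v) =
      if does (FiniteSet._≟_ X x y)
      then crossover H (slice F x y) u v
      else ½ * (pending true H (slice F x y) u v + pending false H (slice F y x) u v)

    pending : ∀ {d} → Bool → (H : Vec FiniteSet d) → Kernel H → Kernel H
    pending b []      F u v = F u v
    pending b (X ∷ H) F (x , u) (y , v) =
      if does (FiniteSet._≟_ X x y)
      then pending b H (slice F x y) u v
      else crossover H (if b then slice F y x else slice F x y) u v

  ∑² : ∀ {d} (H : Vec FiniteSet d) → Kernel H → ℚ
  ∑² H F = ∑[ u ∈ Ω H ] ∑[ v ∈ Ω H ] F u v

  ∑²-∷ : ∀ {d} X (H : Vec FiniteSet d) F → ∑² (X ∷ H) F ≡ ∑[ x ∈ X ] ∑[ y ∈ X ] ∑² H (slice F x y)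
  ∑²-∷ X H F = begin
    ∑² (X ∷ H) F
      ≡⟨ ∑-Ω X H (λ s → ∑ (Ω (X ∷ H)) (F s)) ⟩
    (∑[ x ∈ X ] ∑[ u ∈ Ω H ] ∑ (Ω (X ∷ H)) (F (x , u)))
      ≡⟨ (∑-cong X λ x → ∑-cong (Ω H) λ u → ∑-Ω X H (F (x , u))) ⟩
    (∑[ x ∈ X ] ∑[ u ∈ Ω H ] ∑[ y ∈ X ] ∑[ v ∈ Ω H ] F (x , u) (y , v))
      ≡⟨ (∑-cong X λ x → ∑-swap (Ω H) X (λ u y → ∑[ v ∈ Ω H ] F (x , u) (y , v))) ⟩
    (∑[ x ∈ X ] ∑[ y ∈ X ] ∑² H (slice F x y)) ∎
    where open ≡-Reasoning

  ∑²-½[+] : ∀ {d} (H : Vec FiniteSet d) (F G : Kernel H) →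
    ∑² H (λ u v → ½ * (F u v + G u v)) ≡ ½ * (∑² H F + ∑² H G)
  ∑²-½[+] H F G = begin
    ∑² H (λ u v → ½ * (F u v + G u v))
      ≡⟨ (∑-cong (Ω H) λ u → trans (∑-*ˡ (Ω H) ½ (λ v → F u v + G u v)) (cong (½ *_) (∑-+ (Ω H) (F u) (G u)))) ⟩
    (∑[ u ∈ Ω H ] ½ * (∑ (Ω H) (F u) + ∑ (Ω H) (G u)))
      ≡⟨ ∑-*ˡ (Ω H) ½ (λ u → ∑ (Ω H) (F u) + ∑ (Ω H) (G u)) ⟩
    ½ * (∑[ u ∈ Ω H ] (∑ (Ω H) (F u) + ∑ (Ω H) (G u)))
      ≡⟨ cong (½ *_) (∑-+ (Ω H) (λ u → ∑ (Ω H) (F u)) (λ u → ∑ (Ω H) (G u))) ⟩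
    ½ * (∑² H F + ∑² H G) ∎
    where open ≡-Reasoning

  ½[p+p]≡p : ∀ p → ½ * (p + p) ≡ p
  ½[p+p]≡p = solve 1 (λ p → con ½ :* (p :+ p) := p) refl

  ∑-½[+]-transpose : ∀ X (g : Carrier X → Carrier X → ℚ) →
    ∑[ x ∈ X ] ∑[ y ∈ X ] (½ * (g x y + g y x)) ≡ ∑[ x ∈ X ] ∑[ y ∈ X ] g x y
  ∑-½[+]-transpose X g = begin
    (∑[ x ∈ X ] ∑[ y ∈ X ] (½ * (g x y + g y x)))
      ≡⟨ (∑-cong X λ x → trans (∑-*ˡ X ½ (λ y → g x y + g y x)) (cong (½ *_) (∑-+ X (g x) (λ y → g y x)))) ⟩
    (∑[ x ∈ X ] (½ * (∑ X (g x) + (∑[ y ∈ X ] g y x))))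
      ≡⟨ trans (∑-*ˡ X ½ (λ x → ∑ X (g x) + (∑[ y ∈ X ] g y x)))
           (cong (½ *_) (∑-+ X (λ x → ∑ X (g x)) (λ x → ∑[ y ∈ X ] g y x))) ⟩
    ½ * (G + (∑[ x ∈ X ] ∑[ y ∈ X ] g y x))
      ≡⟨ cong (λ z → ½ * (G + z)) (∑-swap X X (λ x y → g y x)) ⟩
    ½ * (G + G)
      ≡⟨ ½[p+p]≡p G ⟩
    G ∎
    where
    open ≡-Reasoning
    G = ∑[ x ∈ X ] ∑[ y ∈ X ] g x y

  mutual
    -- For fixed coins the exchange is an involution of Ω × Ω. In the recursion: when `x = y` the
    -- two slices coincide, so both branches are the same average over (x , y) and (y , x), and
    -- summing over all x and y undoes the transposition.
    ∑²-crossover : ∀ {d} (H : Vec FiniteSet d) F → ∑² H (crossover H F) ≡ ∑² H F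
    ∑²-crossover []      F = refl
    ∑²-crossover (X ∷ H) F = begin
      ∑² (X ∷ H) (crossover (X ∷ H) F)
        ≡⟨ ∑²-∷ X H (crossover (X ∷ H) F) ⟩
      (∑[ x ∈ X ] ∑[ y ∈ X ] ∑² H (slice (crossover (X ∷ H) F) x y))
        ≡⟨ (∑-cong X λ x → ∑-cong X λ y → go x y (FiniteSet._≟_ X x y)) ⟩
      (∑[ x ∈ X ] ∑[ y ∈ X ] (½ * (∑² H (slice F x y) + ∑² H (slice F y x))))
        ≡⟨ ∑-½[+]-transpose X (λ x y → ∑² H (slice F x y)) ⟩
      (∑[ x ∈ X ] ∑[ y ∈ X ] ∑² H (slice F x y))
        ≡⟨ ∑²-∷ X H F ⟨
      ∑² (X ∷ H) F ∎
      where
      open ≡-Reasoning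
      go : ∀ x y (c : Dec (x ≡ y)) →
        ∑² H (λ u v → if does c
                      then crossover H (slice F x y) u v
                      else ½ * (pending true H (slice F x y) u v + pending false H (slice F y x) u v))
        ≡ ½ * (∑² H (slice F x y) + ∑² H (slice F y x))
      go x y (yes refl) = trans (∑²-crossover H (slice F x x)) (sym (½[p+p]≡p (∑² H (slice F x x))))
      go x y (no _)     = trans (∑²-½[+] H (pending true H (slice F x y)) (pending false H (slice F y x)))
        (cong (½ *_) (cong₂ _+_ (∑²-pending true H (slice F x y)) (∑²-pending false H (slice F y x))))

    ∑²-pending : ∀ {d} b (H : Vec FiniteSet d) F → ∑² H (pending b H F) ≡ ∑² H F
    ∑²-pending b []      F = refl
    ∑²-pending b (X ∷ H) F = begin
      ∑² (X ∷ H) (pending b (X ∷ H) F)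
        ≡⟨ ∑²-∷ X H (pending b (X ∷ H) F) ⟩
      (∑[ x ∈ X ] ∑[ y ∈ X ] ∑² H (slice (pending b (X ∷ H) F) x y))
        ≡⟨ (∑-cong X λ x → ∑-cong X λ y → go b x y (FiniteSet._≟_ X x y)) ⟩
      (∑[ x ∈ X ] ∑[ y ∈ X ] ∑² H (if b then slice F y x else slice F x y))
        ≡⟨ transpose b ⟩
      (∑[ x ∈ X ] ∑[ y ∈ X ] ∑² H (slice F x y))
        ≡⟨ ∑²-∷ X H F ⟨
      ∑² (X ∷ H) F ∎
      where
      open ≡-Reasoning
      go : ∀ b x y (c : Dec (x ≡ y)) →
        ∑² H (λ u v → if does c
                      then pending b H (slice F x y) u v
                      else crossover H (if b then slice F y x else slice F x y) u v)
        ≡ ∑² H (if b then slice F y x else slice F x y)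
      go true  x y (yes refl) = ∑²-pending true  H (slice F x x)
      go false x y (yes refl) = ∑²-pending false H (slice F x x)
      go b     x y (no _)     = ∑²-crossover H (if b then slice F y x else slice F x y)
      transpose : ∀ b → ∑[ x ∈ X ] ∑[ y ∈ X ] ∑² H (if b then slice F y x else slice F x y)
                      ≡ ∑[ x ∈ X ] ∑[ y ∈ X ] ∑² H (slice F x y)
      transpose true  = ∑-swap X X (λ x y → ∑² H (slice F y x))
      transpose false = refl

  mutual
    0≤crossover : ∀ {d} (H : Vec FiniteSet d) {F} → (∀ s t → 0ℚ ≤ F s t) → ∀ u v → 0ℚ ≤ crossover H F u v
    0≤crossover []      0≤F u v = 0≤F u v
    0≤crossover (X ∷ H) {F} 0≤F (x , u) (y , v) = go (FiniteSet._≟_ X x y)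
      where
      go : (c : Dec (x ≡ y)) → 0ℚ ≤ (if does c
        then crossover H (slice F x y) u v
        else ½ * (pending true H (slice F x y) u v + pending false H (slice F y x) u v))
      go (yes _) = 0≤crossover H (λ s t → 0≤F (x , s) (y , t)) u v
      go (no _)  = 0≤* (0≤½) (0≤+ (0≤pending true H (λ s t → 0≤F (x , s) (y , t)) u v)
        (0≤pending false H (λ s t → 0≤F (y , s) (x , t)) u v))

    0≤pending : ∀ {d} b (H : Vec FiniteSet d) {F} → (∀ s t → 0ℚ ≤ F s t) → ∀ u v → 0ℚ ≤ pending b H F u v
    0≤pending b []      0≤F u v = 0≤F u v
    0≤pending b (X ∷ H) {F} 0≤F (x , u) (y , v) = go b (FiniteSet._≟_ X x y)
      where
      go : ∀ b (c : Dec (x ≡ y)) → 0ℚ ≤ (if does c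
        then pending b H (slice F x y) u v
        else crossover H (if b then slice F y x else slice F x y) u v)
      go b     (yes _) = 0≤pending b H (λ s t → 0≤F (x , s) (y , t)) u v
      go true  (no _)  = 0≤crossover H (λ s t → 0≤F (y , s) (x , t)) u v
      go false (no _)  = 0≤crossover H (λ s t → 0≤F (x , s) (y , t)) u v

  -- (s , t) arises from (u , v) by exchanging i of the coordinates at which
  -- u and v differ and keeping the other j.
  data Exchange : ∀ {d} (H : Vec FiniteSet d) (u v s t : Π H) (i j : ℕ) → Set₁ where
    []   : Exchange [] tt tt tt tt 0 0
    same : ∀ {d X} {H : Vec FiniteSet d} {u v s t i j} (x : Carrier X) →
      Exchange H u v s t i j → Exchange (X ∷ H) (x , u) (x , v) (x , s) (x , t) i j
    swap : ∀ {d X} {H : Vec FiniteSet d} {u v s t i j} {x y : Carrier X} → ¬ x ≡ y →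
      Exchange H u v s t i j → Exchange (X ∷ H) (x , u) (y , v) (y , s) (x , t) (suc i) j
    keep : ∀ {d X} {H : Vec FiniteSet d} {u v s t i j} {x y : Carrier X} → ¬ x ≡ y →
      Exchange H u v s t i j → Exchange (X ∷ H) (x , u) (y , v) (x , s) (y , t) i (suc j)

  -- `i` and `j` differ by at most one. They differ exactly when an odd number of coordinates
  -- differ, so that the last one has no partner.
  Balanced : ℕ → ℕ → Set
  Balanced i j = i ℕ.≤ suc j × j ℕ.≤ suc i

  mutual
    crossover-support : ∀ {d} (H : Vec FiniteSet d) F u v →
      (∀ {s t i j} → Exchange H u v s t i j → Balanced i j → F s t ≡ 0ℚ) → crossover H F u v ≡ 0ℚ
    crossover-support []      F tt tt F≡0 = F≡0 [] (z≤n , z≤n)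
    crossover-support (X ∷ H) F (x , u) (y , v) F≡0 = go (FiniteSet._≟_ X x y) F≡0
      where
      go : (c : Dec (x ≡ y)) →
        (∀ {s t i j} → Exchange (X ∷ H) (x , u) (y , v) s t i j → Balanced i j → F s t ≡ 0ℚ) →
        (if does c
         then crossover H (slice F x y) u v
         else ½ * (pending true H (slice F x y) u v + pending false H (slice F y x) u v)) ≡ 0ℚ
      go (yes refl) F≡0 = crossover-support H (slice F x x) u v λ e bal → F≡0 (same x e) bal
      go (no x≢y)   F≡0 = cong₂ (λ p q → ½ * (p + q))
        (pending-support true  H (slice F x y) u v λ e bal → F≡0 (keep x≢y e) bal)
        (pending-support false H (slice F y x) u v λ e bal → F≡0 (swap x≢y e) bal)

    -- `i` and `j` count only the coordinates still ahead, so the one already treated enters as a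
    -- `suc`: on the side of the kept ones for `true`, of the exchanged ones for `false`. Its
    -- partner goes to the other side and restores the balance.
    pending-support : ∀ {d} b (H : Vec FiniteSet d) F u v →
      (∀ {s t i j} → Exchange H u v s t i j →
        (if b then Balanced i (suc j) else Balanced (suc i) j) → F s t ≡ 0ℚ) →
      pending b H F u v ≡ 0ℚ
    pending-support true  [] F tt tt F≡0 = F≡0 [] (z≤n , s≤s z≤n)
    pending-support false [] F tt tt F≡0 = F≡0 [] (s≤s z≤n , z≤n)
    pending-support b (X ∷ H) F (x , u) (y , v) F≡0 = go b (FiniteSet._≟_ X x y) F≡0
      where
      go : ∀ b (c : Dec (x ≡ y)) →
        (∀ {s t i j} → Exchange (X ∷ H) (x , u) (y , v) s t i j →
          (if b then Balanced i (suc j) else Balanced (suc i) j) → F s t ≡ 0ℚ) →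
        (if does c
         then pending b H (slice F x y) u v
         else crossover H (if b then slice F y x else slice F x y) u v) ≡ 0ℚ
      go b     (yes refl) F≡0 = pending-support b H (slice F x x) u v λ e bal → F≡0 (same x e) bal
      go true  (no x≢y)   F≡0 = crossover-support H (slice F y x) u v
        λ e (i≤ , j≤) → F≡0 (swap x≢y e) (s≤s i≤ , s≤s j≤)
      go false (no x≢y)   F≡0 = crossover-support H (slice F x y) u v
        λ e (i≤ , j≤) → F≡0 (keep x≢y e) (s≤s i≤ , s≤s j≤)

  Exchange⇒ℓ₀ : ∀ {d} {H : Vec FiniteSet d} {u v s t i j} → Exchange H u v s t i j →
    (ℓ₀ H s u ≡ i × ℓ₀ H u t ≡ j) × (ℓ₀ H s v ≡ j × ℓ₀ H v t ≡ i) × ℓ₀ H s t ≡ i ℕ.+ j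
  Exchange⇒ℓ₀ [] = (refl , refl) , (refl , refl) , refl
  Exchange⇒ℓ₀ {H = X ∷ H} {_ , u} {_ , v} {_ , s} {_ , t} (same x e) =
    let (su , ut) , (sv , vt) , st = Exchange⇒ℓ₀ e
    in (trans (ℓ₀-≡ X H x s u) su , trans (ℓ₀-≡ X H x u t) ut) ,
       (trans (ℓ₀-≡ X H x s v) sv , trans (ℓ₀-≡ X H x v t) vt) ,
       trans (ℓ₀-≡ X H x s t) st
  Exchange⇒ℓ₀ {H = X ∷ H} {x , u} {y , v} {_ , s} {_ , t} (swap x≢y e) =
    let (su , ut) , (sv , vt) , st = Exchange⇒ℓ₀ e
    in (trans (ℓ₀-≢ X H s u (x≢y ∘ sym)) (cong suc su) , trans (ℓ₀-≡ X H x u t) ut) ,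
       (trans (ℓ₀-≡ X H y s v) sv , trans (ℓ₀-≢ X H v t (x≢y ∘ sym)) (cong suc vt)) ,
       trans (ℓ₀-≢ X H s t (x≢y ∘ sym)) (cong suc st)
  Exchange⇒ℓ₀ {H = X ∷ H} {x , u} {y , v} {_ , s} {_ , t} {i} {suc j} (keep x≢y e) =
    let (su , ut) , (sv , vt) , st = Exchange⇒ℓ₀ e
    in (trans (ℓ₀-≡ X H x s u) su , trans (ℓ₀-≢ X H u t x≢y) (cong suc ut)) ,
       (trans (ℓ₀-≢ X H s v x≢y) (cong suc sv) , trans (ℓ₀-≡ X H y v t) vt) ,
       trans (ℓ₀-≢ X H s t x≢y) (trans (cong suc st) (sym (ℕ.+-suc i j)))

  balanced-halves : ∀ i j → Balanced i j → i ≡ ⌊ i ℕ.+ j /2⌋ ⊎ i ≡ ⌈ i ℕ.+ j /2⌉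
  balanced-halves zero    zero          _         = inj₁ refl
  balanced-halves zero    (suc zero)    _         = inj₁ refl
  balanced-halves (suc zero) zero       _         = inj₂ refl
  balanced-halves zero    (suc (suc j)) (_ , s≤s ())
  balanced-halves (suc (suc i)) zero    (s≤s () , _)
  balanced-halves (suc i) (suc j) (s≤s i≤ , s≤s j≤) rewrite ℕ.+-suc i j
    with balanced-halves i j (i≤ , j≤)
  ... | inj₁ i≡ = inj₁ (cong suc i≡)
  ... | inj₂ i≡ = inj₂ (cong suc i≡)

  module _ {d} (H : Vec FiniteSet d) where
    open BrunnMinkowski (Ω H) (ℓ₀ H)

    Exchange⇒Midpoint : ∀ {u v s t i j} → Exchange H u v s t i j → Balanced i j →
      Midpoint s t u × Midpoint s t v
    Exchange⇒Midpoint {u} {v} {s} {t} {i} {j} e bal@(i≤ , j≤) =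
      let (su , ut) , (sv , vt) , st = Exchange⇒ℓ₀ e in
      midpoint su ut st bal , midpoint sv vt (trans st (ℕ.+-comm i j)) (j≤ , i≤)
      where
      midpoint : ∀ {w i j} → ℓ₀ H s w ≡ i → ℓ₀ H w t ≡ j → ℓ₀ H s t ≡ i ℕ.+ j → Balanced i j → Midpoint s t w
      midpoint {w} {i} {j} sw wt st bal = Sum.map
        (λ i≡ → trans sw (trans i≡ (cong ⌊_/2⌋ (sym st))) , sum)
        (λ i≡ → trans sw (trans i≡ (cong ⌈_/2⌉ (sym st))) , sum)
        (balanced-halves i j bal)
        where
        sum : ℓ₀ H s w ℕ.+ ℓ₀ H w t ≡ ℓ₀ H s t
        sum = trans (cong₂ ℕ._+_ sw wt) (sym st)

-- The Chernoff bound for two independent crossovers.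

-- r is 1/β, so that ch = cosh (log β).
module CrossoverBound (β r : ℚ) (1≤β : 1ℚ ℚ.≤ β) (0≤r : 0ℚ ℚ.≤ r) (βr≡1 : β ℚ.* r ≡ 1ℚ) where
  open import Data.Rational.Base using (_+_; _*_; _-_; _≤_)
  open +-*-Solver
  open OrderedField
  open Distance
  open Crossover

  ch : ℚ
  ch = ½ * (β + r)

  0≤β : 0ℚ ≤ β
  0≤β = ℚ.≤-trans (0≤ℕtoℚ 1) 1≤β

  0≤ch : 0ℚ ≤ ch
  0≤ch = 0≤* 0≤½ (0≤+ 0≤β 0≤r)

  -- Because β + 1/β - 2 = (β - 1)²/β.
  2≤β+r : 1ℚ + 1ℚ ≤ β + r
  2≤β+r = 0≤q-p⇒p≤q (subst (0ℚ ≤_) eq (0≤* (0≤* 0≤β-1 0≤β-1) 0≤r))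
    where
    0≤β-1 : 0ℚ ≤ β - 1ℚ
    0≤β-1 = p≤q⇒0≤q-p 1≤β
    eq : (β - 1ℚ) * (β - 1ℚ) * r ≡ β + r - (1ℚ + 1ℚ)
    eq = trans (solve 2 (λ β r → (β :- con 1ℚ) :* (β :- con 1ℚ) :* r :=
             β :* (β :* r) :+ r :- (con 1ℚ :+ con 1ℚ) :* (β :* r)) refl β r)
      (trans (cong (λ e → β * e + r - (1ℚ + 1ℚ) * e) βr≡1)
        (solve 2 (λ β r → β :* con 1ℚ :+ r :- (con 1ℚ :+ con 1ℚ) :* con 1ℚ :=
           β :+ r :- (con 1ℚ :+ con 1ℚ)) refl β r))

  1≤ch : 1ℚ ≤ ch
  1≤ch = *-monoˡ 0≤½ 2≤β+r

  -- The four products uᵢwⱼ have diagonal terms z, z′ ≤ Yγ and z z′ ≤ Y², and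
  -- (Yγ − z)(Yγ − z′) ≥ 0 turns this into z + z′ ≤ Y(γ + 1/γ).
  average-*-average-≤ : ∀ {Y γ ρ u₀ u₁ w₀ w₁} → 0ℚ ≤ Y → 0ℚ ≤ γ → 0ℚ ≤ ρ → γ * ρ ≡ 1ℚ →
    0ℚ ≤ u₀ → 0ℚ ≤ u₁ → 0ℚ ≤ w₀ → 0ℚ ≤ w₁ →
    u₀ * w₀ ≤ Y * γ → u₁ * w₁ ≤ Y * γ → u₀ * w₁ ≤ Y → u₁ * w₀ ≤ Y →
    ½ * (u₀ + u₁) * (½ * (w₀ + w₁)) ≤ Y * (½ * ½ * (1ℚ + 1ℚ + (γ + ρ)))
  average-*-average-≤ {Y} {γ} {ρ} {u₀} {u₁} {w₀} {w₁} 0≤Y 0≤γ 0≤ρ γρ≡1 0≤u₀ 0≤u₁ 0≤w₀ 0≤w₁ z≤ z′≤ c≤ c′≤ = begin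
    ½ * (u₀ + u₁) * (½ * (w₀ + w₁))
      ≡⟨ solve 4 (λ a b c d → con ½ :* (a :+ b) :* (con ½ :* (c :+ d)) :=
           con ½ :* con ½ :* (a :* d :+ b :* c :+ (a :* c :+ b :* d))) refl u₀ u₁ w₀ w₁ ⟩
    ½ * ½ * (u₀ * w₁ + u₁ * w₀ + (z + z′))
      ≤⟨ *-monoˡ (0≤* 0≤½ 0≤½) (ℚ.+-mono-≤ (ℚ.+-mono-≤ c≤ c′≤) z+z′≤) ⟩
    ½ * ½ * (Y + Y + Y * (γ + ρ))
      ≡⟨ solve 2 (λ Y g → con ½ :* con ½ :* (Y :+ Y :+ Y :* g) :=
           Y :* (con ½ :* con ½ :* (con 1ℚ :+ con 1ℚ :+ g))) refl Y (γ + ρ) ⟩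
    Y * (½ * ½ * (1ℚ + 1ℚ + (γ + ρ))) ∎
    where
    open ℚ.≤-Reasoning
    z = u₀ * w₀
    z′ = u₁ * w₁
    -- The product of the diagonal terms is also the product of the off-diagonal ones; this is what
    -- improves on averaging four separate bounds.
    zz′≤Y² : z * z′ ≤ Y * Y
    zz′≤Y² = subst (_≤ Y * Y)
      (solve 4 (λ a b c d → a :* d :* (b :* c) := a :* c :* (b :* d)) refl u₀ u₁ w₀ w₁)
      (*-mono (0≤* 0≤u₀ 0≤w₁) (0≤* 0≤u₁ 0≤w₀) c≤ c′≤)
    0≤gap : 0ℚ ≤ Y * (Y * γ) - Y * (z + z′) + z * z′ * ρ
    0≤gap = subst (0ℚ ≤_)
      (trans (solve 5 (λ Y γ ρ z z′ → (Y :* γ :- z) :* (Y :* γ :- z′) :* ρ :=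
          Y :* (Y :* γ) :* (γ :* ρ) :- Y :* (z :+ z′) :* (γ :* ρ) :+ z :* z′ :* ρ) refl Y γ ρ z z′)
        (trans (cong (λ e → Y * (Y * γ) * e - Y * (z + z′) * e + z * z′ * ρ) γρ≡1)
          (cong₂ (λ a b → a - b + z * z′ * ρ) (ℚ.*-identityʳ (Y * (Y * γ))) (ℚ.*-identityʳ (Y * (z + z′))))))
      (0≤* (0≤* (p≤q⇒0≤q-p z≤) (p≤q⇒0≤q-p z′≤)) 0≤ρ)
    Y[z+z′]≤ : Y * (z + z′) ≤ Y * (Y * (γ + ρ))
    Y[z+z′]≤ = begin
      Y * (z + z′)                    ≤⟨ 0≤q-p⇒p≤q (subst (0ℚ ≤_)
                                           (solve 3 (λ a b c → a :- b :+ c := a :+ c :- b) refl (Y * (Y * γ)) (Y * (z + z′)) (z * z′ * ρ)) 0≤gap) ⟩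
      Y * (Y * γ) + z * z′ * ρ        ≤⟨ ℚ.+-monoʳ-≤ (Y * (Y * γ)) (*-monoʳ 0≤ρ zz′≤Y²) ⟩
      Y * (Y * γ) + Y * Y * ρ         ≡⟨ solve 3 (λ Y γ ρ → Y :* (Y :* γ) :+ Y :* Y :* ρ := Y :* (Y :* (γ :+ ρ))) refl Y γ ρ ⟩
      Y * (Y * (γ + ρ))               ∎
    z+z′≤ : z + z′ ≤ Y * (γ + ρ)
    -- A factor Y has to be cancelled. If it is zero, the bounds `Y * γ` already force z and z′ to
    -- be nonpositive.
    z+z′≤ with 0ℚ ℚ.<? Y
    ... | yes 0<Y = ℚ.*-cancelˡ-≤-pos Y {{ℚ.positive 0<Y}} Y[z+z′]≤
    ... | no  0≮Y = ℚ.≤-trans (ℚ.+-mono-≤ (vanish z≤) (vanish z′≤)) (0≤* 0≤Y (0≤+ 0≤γ 0≤ρ))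
      where
      vanish : ∀ {p} → p ≤ Y * γ → p ≤ 0ℚ
      vanish p≤ = ℚ.≤-trans p≤ (subst (Y * γ ≤_) (ℚ.*-zeroˡ γ) (*-monoʳ 0≤γ (ℚ.≮⇒≥ 0≮Y)))

  -- The first point of one outcome is compared with the second point of the other. For the
  -- indicator of S × T and `C` = β⁻ᴰ this encodes that S and T have distance at least D. Two
  -- kernels are needed because different coins lead to different slices; `C` collects a factor β
  -- for each coordinate passed at which s and t′ differ.
  record Dominated {d} (H : Vec FiniteSet d) (C : ℚ) (F G : Kernel H) : Set where
    constructor dominated
    field
      bound : ∀ s t s′ t′ → F s t * G s′ t′ ≤ C * β ^ ℓ₀ H s t′

  open Dominated

  module _ {d} (X : FiniteSet) (H : Vec FiniteSet d) {C : ℚ} {F G : Kernel (X ∷ H)}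
           (F⊗G≤ : Dominated (X ∷ H) C F G) where

    dominated-≡ : ∀ x y x′ → Dominated H C (slice F x y) (slice G x′ x)
    dominated-≡ x y x′ = dominated λ s t s′ t′ →
      subst (λ k → F (x , s) (y , t) * G (x′ , s′) (x , t′) ≤ C * β ^ k) (ℓ₀-≡ X H x s t′) (F⊗G≤ .bound _ _ _ _)

    dominated-≢ : ∀ x y x′ y′ → ¬ x ≡ y′ → Dominated H (C * β) (slice F x y) (slice G x′ y′)
    dominated-≢ x y x′ y′ x≢y′ = dominated λ s t s′ t′ →
      subst (F (x , s) (y , t) * G (x′ , s′) (y′ , t′) ≤_)
        (trans (cong (λ k → C * β ^ k) (ℓ₀-≢ X H s t′ x≢y′)) (sym (ℚ.*-assoc C β (β ^ ℓ₀ H s t′))))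
        (F⊗G≤ .bound _ _ _ _)

  -- The index counts the differing coordinates still ahead while a pair is open. The first of them
  -- is the missing partner: it costs β if the two coins of the pair are equal and nothing if they
  -- are opposite. Index zero means that no partner follows.
  sameBound oppositeBound : ℚ → ℕ → ℚ
  sameBound C zero    = C
  sameBound C (suc k) = C * β * ch ^ k
  oppositeBound C zero    = C
  oppositeBound C (suc k) = C * ch ^ k

  -- A complete pair has γ = β² and yields (2 + β² + β⁻²)/4, which is exactly `ch` squared. A last
  -- coordinate without partner has γ = β and yields (2 + β + β⁻¹)/4, which is at most `ch` by
  -- `2≤β+r`.
  average-bound : ∀ k {C u₀ u₁ w₀ w₁} → 0ℚ ≤ C → 0ℚ ≤ u₀ → 0ℚ ≤ u₁ → 0ℚ ≤ w₀ → 0ℚ ≤ w₁ →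
    u₀ * w₀ ≤ sameBound (C * β) k → u₁ * w₁ ≤ sameBound (C * β) k →
    u₀ * w₁ ≤ oppositeBound C k → u₁ * w₀ ≤ oppositeBound C k →
    ½ * (u₀ + u₁) * (½ * (w₀ + w₁)) ≤ C * ch ^ suc k
  average-bound zero {C} 0≤C 0≤u₀ 0≤u₁ 0≤w₀ 0≤w₁ s₀ s₁ o₀ o₁ = ℚ.≤-trans
    (average-*-average-≤ 0≤C 0≤β 0≤r βr≡1 0≤u₀ 0≤u₁ 0≤w₀ 0≤w₁ s₀ s₁ o₀ o₁)
    (*-monoˡ 0≤C (subst (½ * ½ * (1ℚ + 1ℚ + (β + r)) ≤_)
      (solve 1 (λ g → con ½ :* con ½ :* (g :+ g) := con ½ :* g :* con 1ℚ) refl (β + r))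
      (*-monoˡ (0≤* 0≤½ 0≤½) (ℚ.+-monoˡ-≤ (β + r) 2≤β+r))))
  average-bound (suc k) {C} {u₀} {u₁} {w₀} {w₁} 0≤C 0≤u₀ 0≤u₁ 0≤w₀ 0≤w₁ s₀ s₁ o₀ o₁ =
    subst (½ * (u₀ + u₁) * (½ * (w₀ + w₁)) ≤_) eq
      (average-*-average-≤ (0≤* 0≤C (0≤^ k 0≤ch)) (0≤* 0≤β 0≤β) (0≤* 0≤r 0≤r) ββrr≡1 0≤u₀ 0≤u₁ 0≤w₀ 0≤w₁
        (subst (u₀ * w₀ ≤_) same≡ s₀) (subst (u₁ * w₁ ≤_) same≡ s₁) o₀ o₁)
    where
    same≡ : C * β * β * ch ^ k ≡ C * ch ^ k * (β * β)
    same≡ = solve 3 (λ C β p → C :* β :* β :* p := C :* p :* (β :* β)) refl C β (ch ^ k)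
    ββrr≡1 : β * β * (r * r) ≡ 1ℚ
    ββrr≡1 = trans (solve 2 (λ β r → β :* β :* (r :* r) := β :* r :* (β :* r)) refl β r) (cong₂ _*_ βr≡1 βr≡1)
    eq : C * ch ^ k * (½ * ½ * (1ℚ + 1ℚ + (β * β + r * r))) ≡ C * ch ^ suc (suc k)
    eq = trans
      (cong (λ e → C * ch ^ k * (½ * ½ * (e + e + (β * β + r * r)))) (sym βr≡1))
      (solve 4 (λ C p β r → C :* p :* (con ½ :* con ½ :* (β :* r :+ β :* r :+ (β :* β :+ r :* r))) :=
         C :* (con ½ :* (β :+ r) :* (con ½ :* (β :+ r) :* p))) refl C (ch ^ k) β r)

  mutual
    crossover-bound : ∀ {d} (H : Vec FiniteSet d) {C F G} → 0ℚ ≤ C →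
      (∀ s t → 0ℚ ≤ F s t) → (∀ s t → 0ℚ ≤ G s t) → Dominated H C F G →
      ∀ u v → crossover H F u v * crossover H G u v ≤ C * ch ^ ℓ₀ H u v
    crossover-bound []      0≤C 0≤F 0≤G F⊗G≤ tt tt = F⊗G≤ .bound tt tt tt tt
    crossover-bound (X ∷ H) {C} {F} {G} 0≤C 0≤F 0≤G F⊗G≤ (x , u) (y , v) = go (FiniteSet._≟_ X x y)
      where
      0≤slice : ∀ {F : Kernel (X ∷ H)} → (∀ s t → 0ℚ ≤ F s t) → ∀ x y s t → 0ℚ ≤ slice F x y s t
      0≤slice 0≤F x y s t = 0≤F (x , s) (y , t)
      step : Dec (x ≡ y) → Kernel (X ∷ H) → ℚ
      step c F = if does c
        then crossover H (slice F x y) u v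
        else ½ * (pending true H (slice F x y) u v + pending false H (slice F y x) u v)
      go : (c : Dec (x ≡ y)) → step c F * step c G ≤ C * ch ^ ℓ₀ (X ∷ H) (x , u) (y , v)
      go (yes refl) = subst (λ k → crossover H (slice F x x) u v * crossover H (slice G x x) u v ≤ C * ch ^ k)
        (sym (ℓ₀-≡ X H x u v))
        (crossover-bound H 0≤C (0≤slice 0≤F x x) (0≤slice 0≤G x x) (dominated-≡ X H F⊗G≤ x x x) u v)
      go (no x≢y) = subst (λ k → step (no x≢y) F * step (no x≢y) G ≤ C * ch ^ k) (sym (ℓ₀-≢ X H u v x≢y))
        (average-bound (ℓ₀ H u v) 0≤C
          (0≤pending true H (0≤slice 0≤F x y) u v) (0≤pending false H (0≤slice 0≤F y x) u v)
          (0≤pending true H (0≤slice 0≤G x y) u v) (0≤pending false H (0≤slice 0≤G y x) u v)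
          -- With equal coins s and t′ receive different entries here, hence the constant `C * β`;
          -- with opposite coins they receive the same entry and `C` is unchanged.
          (pending-same true H (0≤* 0≤C 0≤β) (0≤slice 0≤F x y) (0≤slice 0≤G x y) (dominated-≢ X H F⊗G≤ x y x y x≢y) u v)
          (pending-same false H (0≤* 0≤C 0≤β) (0≤slice 0≤F y x) (0≤slice 0≤G y x) (dominated-≢ X H F⊗G≤ y x y x (x≢y ∘ sym)) u v)
          (pending-opposite true H 0≤C (0≤slice 0≤F x y) (0≤slice 0≤G y x) (dominated-≡ X H F⊗G≤ x y y) u v)
          (pending-opposite false H 0≤C (0≤slice 0≤F y x) (0≤slice 0≤G x y) (dominated-≡ X H F⊗G≤ y x x) u v))

    pending-same : ∀ {d} b (H : Vec FiniteSet d) {C F G} → 0ℚ ≤ C →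
      (∀ s t → 0ℚ ≤ F s t) → (∀ s t → 0ℚ ≤ G s t) → Dominated H C F G →
      ∀ u v → pending b H F u v * pending b H G u v ≤ sameBound C (ℓ₀ H u v)
    pending-same b [] {C} 0≤C 0≤F 0≤G F⊗G≤ tt tt = subst (_ ≤_) (ℚ.*-identityʳ C) (F⊗G≤ .bound tt tt tt tt)
    pending-same b (X ∷ H) {C} {F} {G} 0≤C 0≤F 0≤G F⊗G≤ (x , u) (y , v) = go b (FiniteSet._≟_ X x y)
      where
      step : Bool → Dec (x ≡ y) → Kernel (X ∷ H) → ℚ
      step b c F = if does c
        then pending b H (slice F x y) u v
        else crossover H (if b then slice F y x else slice F x y) u v
      go : ∀ b (c : Dec (x ≡ y)) → step b c F * step b c G ≤ sameBound C (ℓ₀ (X ∷ H) (x , u) (y , v))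
      go b (yes refl) = subst (λ k → step b (yes refl) F * step b (yes refl) G ≤ sameBound C k) (sym (ℓ₀-≡ X H x u v))
        (pending-same b H 0≤C (λ s t → 0≤F (x , s) (x , t)) (λ s t → 0≤G (x , s) (x , t)) (dominated-≡ X H F⊗G≤ x x x) u v)
      go true (no x≢y) = subst (λ k → step true (no x≢y) F * step true (no x≢y) G ≤ sameBound C k) (sym (ℓ₀-≢ X H u v x≢y))
        (crossover-bound H (0≤* 0≤C 0≤β) (λ s t → 0≤F (y , s) (x , t)) (λ s t → 0≤G (y , s) (x , t))
          (dominated-≢ X H F⊗G≤ y x y x (x≢y ∘ sym)) u v)
      go false (no x≢y) = subst (λ k → step false (no x≢y) F * step false (no x≢y) G ≤ sameBound C k) (sym (ℓ₀-≢ X H u v x≢y))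
        (crossover-bound H (0≤* 0≤C 0≤β) (λ s t → 0≤F (x , s) (y , t)) (λ s t → 0≤G (x , s) (y , t))
          (dominated-≢ X H F⊗G≤ x y x y x≢y) u v)

    pending-opposite : ∀ {d} b (H : Vec FiniteSet d) {C F G} → 0ℚ ≤ C →
      (∀ s t → 0ℚ ≤ F s t) → (∀ s t → 0ℚ ≤ G s t) → Dominated H C F G →
      ∀ u v → pending b H F u v * pending (not b) H G u v ≤ oppositeBound C (ℓ₀ H u v)
    pending-opposite b [] {C} 0≤C 0≤F 0≤G F⊗G≤ tt tt = subst (_ ≤_) (ℚ.*-identityʳ C) (F⊗G≤ .bound tt tt tt tt)
    pending-opposite b (X ∷ H) {C} {F} {G} 0≤C 0≤F 0≤G F⊗G≤ (x , u) (y , v) = go b (FiniteSet._≟_ X x y)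
      where
      step : Bool → Dec (x ≡ y) → Kernel (X ∷ H) → ℚ
      step b c F = if does c
        then pending b H (slice F x y) u v
        else crossover H (if b then slice F y x else slice F x y) u v
      go : ∀ b (c : Dec (x ≡ y)) → step b c F * step (not b) c G ≤ oppositeBound C (ℓ₀ (X ∷ H) (x , u) (y , v))
      go b (yes refl) = subst (λ k → step b (yes refl) F * step (not b) (yes refl) G ≤ oppositeBound C k) (sym (ℓ₀-≡ X H x u v))
        (pending-opposite b H 0≤C (λ s t → 0≤F (x , s) (x , t)) (λ s t → 0≤G (x , s) (x , t)) (dominated-≡ X H F⊗G≤ x x x) u v)
      go true (no x≢y) = subst (λ k → step true (no x≢y) F * step false (no x≢y) G ≤ oppositeBound C k) (sym (ℓ₀-≢ X H u v x≢y))
        (crossover-bound H 0≤C (λ s t → 0≤F (y , s) (x , t)) (λ s t → 0≤G (x , s) (y , t))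
          (dominated-≡ X H F⊗G≤ y x x) u v)
      go false (no x≢y) = subst (λ k → step false (no x≢y) F * step true (no x≢y) G ≤ oppositeBound C k) (sym (ℓ₀-≢ X H u v x≢y))
        (crossover-bound H 0≤C (λ s t → 0≤F (x , s) (y , t)) (λ s t → 0≤G (y , s) (x , t))
          (dominated-≡ X H F⊗G≤ x y y) u v)

-- From the crossover bound to the number of midpoints.

module MidpointCount where
  open import Data.Rational.Base using (_+_; _*_; _≤_)
  open +-*-Solver
  open OrderedField
  open Exponential
  open Summation
  open Crossover

  ∈-toList : ∀ {X} (S : Subset X) {x} → member S x → x List.∈ toList S
  ∈-toList {X} S {x} x∈S = ∈-filter⁺ (member? S)
    (subst (List._∈ FiniteSet.elements X) (Inverse.strictlyInverseʳ enum x)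
      (∈-map⁺ (Inverse.from enum) (∈-allFin (Inverse.to enum x))))
    x∈S
    where open FiniteSet X using (enum)

  d⋆-≤ : ∀ {X} (dist : Carrier X → Carrier X → ℕ) (S T : Subset X) neS neT →
    let open BrunnMinkowski X dist in
    ∀ {s t} → member S s → member T t → d⋆ S T neS neT ℕ.≤ dist s t
  d⋆-≤ dist S T (s₀ , _) (t₀ , _) s∈S t∈T =
    ListAll.lookup (min≤xs (dist s₀ t₀) (cartesianProductWith dist (toList S) (toList T)))
      (∈-cartesianProductWith⁺ dist (∈-toList S s∈S) (∈-toList T t∈T))

  ℓ₀-≤ : ∀ {d} (H : Vec FiniteSet d) s t → ℓ₀ H s t ℕ.≤ d
  ℓ₀-≤ {d} H s t = subst (ℓ₀ H s t ℕ.≤_) (length-tabulate {n = d} (λ i → i)) (length-filter _ (allFin d))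

  𝟙≤1 : ∀ {P : Set} (c : Dec P) → 𝟙 c ≤ 1ℚ
  𝟙≤1 (yes _) = ℚ.≤-refl
  𝟙≤1 (no _)  = 0≤ℕtoℚ 1

  module _ {d} (H : Vec FiniteSet d) (S T : Subset (Ω H)) (neS : Nonempty S) (neT : Nonempty T) where
    open BrunnMinkowski (Ω H) (ℓ₀ H)

    D : ℕ
    D = d⋆ S T neS neT

    F : Kernel H
    F s t = 𝟙 (member? S s) * 𝟙 (member? T t)

    0≤F : ∀ s t → 0ℚ ≤ F s t
    0≤F s t = 0≤* (0≤𝟙 (member? S s)) (0≤𝟙 (member? T t))

    ∑²-F : ∑² H F ≡ ℕtoℚ (∣ S ∣ ℕ.* ∣ T ∣)
    ∑²-F = trans (∑-⊗ (Ω H) (Ω H) (λ s → 𝟙 (member? S s)) (λ t → 𝟙 (member? T t)))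
      (trans (cong₂ _*_ (sym (∣∣≡∑𝟙 S)) (sym (∣∣≡∑𝟙 T))) (sym (ℕtoℚ-homo-* ∣ S ∣ ∣ T ∣)))

    D≤d : D ℕ.≤ d
    D≤d = ℕ.≤-trans (d⋆-≤ (ℓ₀ H) S T neS neT (proj₂ neS) (proj₂ neT)) (ℓ₀-≤ H (proj₁ neS) (proj₁ neT))

    F≡0 : ∀ s t → ¬ (member S s × member T t) → F s t ≡ 0ℚ
    F≡0 s t ¬∈ = go (member? S s) (member? T t)
      where
      go : (c : Dec (member S s)) (c′ : Dec (member T t)) → 𝟙 c * 𝟙 c′ ≡ 0ℚ
      go (yes s∈S) (yes t∈T) = contradiction (s∈S , t∈T) ¬∈
      go (yes _)   (no _)    = refl
      go (no _)    c′        = ℚ.*-zeroˡ (𝟙 c′)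

    crossover-F≡0 : ∀ u v → ¬ (member (m̂ S T) u × member (m̂ S T) v) → crossover H F u v ≡ 0ℚ
    crossover-F≡0 u v ¬∈ = crossover-support H F u v λ {s} {t} e bal → F≡0 s t λ (s∈S , t∈T) →
      let mu , mv = Exchange⇒Midpoint H e bal
      in ¬∈ ((s , t , s∈S , t∈T , mu) , (s , t , s∈S , t∈T , mv))

    module _ {β r q : ℚ} (1≤β : 1ℚ ≤ β) (0≤r : 0ℚ ≤ r) (βr≡1 : β * r ≡ 1ℚ) (0≤q : 0ℚ ≤ q)
             (q²cosh^d≤β^D : q * q * (½ * (β + r)) ^ d ≤ β ^ D) where
      open CrossoverBound β r 1≤β 0≤r βr≡1

      r^n*β^n≡1 : ∀ n → r ^ n * β ^ n ≡ 1ℚ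
      r^n*β^n≡1 zero    = refl
      r^n*β^n≡1 (suc n) = trans
        (solve 4 (λ r β p q → r :* p :* (β :* q) := β :* r :* (p :* q)) refl r β (r ^ n) (β ^ n))
        (cong₂ _*_ βr≡1 (r^n*β^n≡1 n))

      0≤r^D : 0ℚ ≤ r ^ D
      0≤r^D = 0≤^ D 0≤r

      -- The left side is at most 1 and vanishes unless s ∈ S and t′ ∈ T; in that case
      -- `D ≤ ℓ₀ H s t′`, so the right side is at least `r ^ D * β ^ D`, which is 1.
      F-dominated : Dominated H (r ^ D) F F
      F-dominated = dominated λ s t s′ t′ → go s t′ (member? S s) (member? T t′)
        (0≤𝟙 (member? T t)) (0≤𝟙 (member? S s′)) (𝟙≤1 (member? T t)) (𝟙≤1 (member? S s′))
        where
        go : ∀ s t′ (c : Dec (member S s)) (c′ : Dec (member T t′)) {a b} →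
          0ℚ ≤ a → 0ℚ ≤ b → a ≤ 1ℚ → b ≤ 1ℚ → 𝟙 c * a * (b * 𝟙 c′) ≤ r ^ D * β ^ ℓ₀ H s t′
        go s t′ (no _) c′ {a} {b} _ _ _ _ = subst (_≤ r ^ D * β ^ ℓ₀ H s t′)
          (solve 3 (λ a b c → con 0ℚ := con 0ℚ :* a :* (b :* c)) refl a b (𝟙 c′))
          (0≤* 0≤r^D (0≤^ (ℓ₀ H s t′) 0≤β))
        go s t′ (yes _) (no _) {a} {b} _ _ _ _ = subst (_≤ r ^ D * β ^ ℓ₀ H s t′)
          (solve 2 (λ a b → con 0ℚ := con 1ℚ :* a :* (b :* con 0ℚ)) refl a b)
          (0≤* 0≤r^D (0≤^ (ℓ₀ H s t′) 0≤β))
        go s t′ (yes s∈S) (yes t′∈T) {a} {b} 0≤a 0≤b a≤1 b≤1 = begin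
          1ℚ * a * (b * 1ℚ)          ≡⟨ solve 2 (λ a b → con 1ℚ :* a :* (b :* con 1ℚ) := a :* b) refl a b ⟩
          a * b                      ≤⟨ *-mono 0≤a 0≤b a≤1 b≤1 ⟩
          1ℚ                         ≡⟨ r^n*β^n≡1 D ⟨
          r ^ D * β ^ D              ≤⟨ *-monoˡ 0≤r^D (^-monoʳ 1≤β (d⋆-≤ (ℓ₀ H) S T neS neT s∈S t′∈T)) ⟩
          r ^ D * β ^ ℓ₀ H s t′      ∎
          where open ℚ.≤-Reasoning

      crossover-F-≤ : ∀ u v → q * crossover H F u v ≤ 1ℚ
      crossover-F-≤ u v = square-cancel-≤ (0≤ℕtoℚ 1) (begin
        q * A * (q * A)                  ≡⟨ solve 2 (λ q a → q :* a :* (q :* a) := q :* q :* (a :* a)) refl q A ⟩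
        q * q * (A * A)                  ≤⟨ *-monoˡ (0≤* 0≤q 0≤q) (crossover-bound H 0≤r^D 0≤F 0≤F F-dominated u v) ⟩
        q * q * (r ^ D * ch ^ ℓ₀ H u v)  ≤⟨ *-monoˡ (0≤* 0≤q 0≤q) (*-monoˡ 0≤r^D (^-monoʳ 1≤ch (ℓ₀-≤ H u v))) ⟩
        q * q * (r ^ D * ch ^ d)         ≡⟨ solve 3 (λ q r c → q :* q :* (r :* c) := r :* (q :* q :* c)) refl q (r ^ D) (ch ^ d) ⟩
        r ^ D * (q * q * ch ^ d)         ≤⟨ *-monoˡ 0≤r^D q²cosh^d≤β^D ⟩
        r ^ D * β ^ D                    ≡⟨ r^n*β^n≡1 D ⟩
        1ℚ                               ∎)
        where
        open ℚ.≤-Reasoning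
        A = crossover H F u v

      𝟙ₘ : Π H → ℚ
      𝟙ₘ u = 𝟙 (member? (m̂ S T) u)

      crossover-F-≤-𝟙 : ∀ u v → q * crossover H F u v ≤ 𝟙ₘ u * 𝟙ₘ v
      crossover-F-≤-𝟙 u v = go (member? (m̂ S T) u) (member? (m̂ S T) v)
        where
        vanish : ¬ (member (m̂ S T) u × member (m̂ S T) v) → ∀ {p} → 0ℚ ≤ p → q * crossover H F u v ≤ p
        vanish ¬∈ {p} 0≤p = subst (_≤ p) (sym (trans (cong (q *_) (crossover-F≡0 u v ¬∈)) (ℚ.*-zeroʳ q))) 0≤p
        go : (c : Dec (member (m̂ S T) u)) (c′ : Dec (member (m̂ S T) v)) → q * crossover H F u v ≤ 𝟙 c * 𝟙 c′
        go (yes _)  (yes _)     = crossover-F-≤ u v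
        go (no u∉)  c′          = vanish (u∉ ∘ proj₁) (0≤* ℚ.≤-refl (0≤𝟙 c′))
        go (yes u∈) (no v∉)     = vanish (v∉ ∘ proj₂) (0≤* (0≤ℕtoℚ 1) ℚ.≤-refl)

      -- Double counting: the crossover spreads |S||T| over pairs of midpoints, each receiving at
      -- most 1/q. It is applied with `q` the square of a partial sum of exp x, so `q * q` is the
      -- fourth power bounded above.
      q*∣S∣∣T∣≤∣m̂∣² : q * ℕtoℚ (∣ S ∣ ℕ.* ∣ T ∣) ≤ ℕtoℚ ∣ m̂ S T ∣ * ℕtoℚ ∣ m̂ S T ∣
      q*∣S∣∣T∣≤∣m̂∣² = begin
        q * ℕtoℚ (∣ S ∣ ℕ.* ∣ T ∣)
          ≡⟨ cong (q *_) (trans (sym ∑²-F) (sym (∑²-crossover H F))) ⟩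
        q * ∑² H (crossover H F)
          ≡⟨ trans (sym (∑-*ˡ (Ω H) q (λ u → ∑ (Ω H) (crossover H F u))))
               (∑-cong (Ω H) λ u → sym (∑-*ˡ (Ω H) q (crossover H F u))) ⟩
        ∑² H (λ u v → q * crossover H F u v)
          ≤⟨ ∑-mono (Ω H) (λ u → ∑-mono (Ω H) (crossover-F-≤-𝟙 u)) ⟩
        ∑² H (λ u v → 𝟙ₘ u * 𝟙ₘ v)
          ≡⟨ trans (∑-⊗ (Ω H) (Ω H) 𝟙ₘ 𝟙ₘ) (cong₂ _*_ (sym (∣∣≡∑𝟙 (m̂ S T))) (sym (∣∣≡∑𝟙 (m̂ S T)))) ⟩
        ℕtoℚ ∣ m̂ S T ∣ * ℕtoℚ ∣ m̂ S T ∣ ∎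
        where open ℚ.≤-Reasoning

  -- A rational below the product is either negative or below some `a * b` with a² ≤ n and b at most
  -- one partial sum of the exponential. Hence the comparison of reals reduces, after squaring, to
  -- one rational inequality for each partial sum.
  √*exp-≤ : ∀ n m x → 0ℚ ≤ x → (∀ k → expSum x k * expSum x k * ℕtoℚ n ≤ ℕtoℚ m * ℕtoℚ m) →
    √ n *₊ exp x ≤ℝ ℕtoℝ m
  √*exp-≤ n m x 0≤x E²n≤m² (_ , q<0 , inj₁ refl) = ℕtoℚ m , ℚ.<-≤-trans q<0 (0≤ℕtoℚ m) , refl
  √*exp-≤ n m x 0≤x E²n≤m²
    (_ , q<ab , inj₂ (a , b , 0≤a , 0≤b , (a′ , a<a′ , a′²≤n) , (b′ , b<b′ , M , b′≤E) , refl)) =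
    ℕtoℚ m , ℚ.<-≤-trans q<ab (square-cancel-≤ (0≤ℕtoℚ m) (begin
      a * b * (a * b)    ≡⟨ solve 2 (λ a b → a :* b :* (a :* b) := b :* b :* (a :* a)) refl a b ⟩
      b * b * (a * a)    ≤⟨ *-mono (0≤* 0≤b 0≤b) (0≤* 0≤a 0≤a) (*-mono 0≤b 0≤b b≤E b≤E)
                              (ℚ.≤-trans (*-mono 0≤a 0≤a (ℚ.<⇒≤ a<a′) (ℚ.<⇒≤ a<a′)) a′²≤n) ⟩
      E * E * ℕtoℚ n     ≤⟨ E²n≤m² M ⟩
      ℕtoℚ m * ℕtoℚ m    ∎)) , refl
    where
    open ℚ.≤-Reasoning
    E = expSum x M
    b≤E : b ≤ E
    b≤E = ℚ.≤-trans (ℚ.<⇒≤ b<b′) (b′≤E M ℕ.≤-refl)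

  *-inverse-unique : ∀ n .{{_ : ℕ.NonZero n}} {p} → ℕtoℚ n * p ≡ 1ℚ → p ≡ ℤ.+ 1 / n
  *-inverse-unique n {p} np≡1 = begin
    p                          ≡⟨ ℚ.*-identityˡ p ⟨
    1ℚ * p                     ≡⟨ cong (_* p) (ℕtoℚ-*-inverse n) ⟨
    ℕtoℚ n * (ℤ.+ 1 / n) * p   ≡⟨ solve 3 (λ n u p → n :* u :* p := n :* p :* u) refl (ℕtoℚ n) (ℤ.+ 1 / n) p ⟩
    ℕtoℚ n * p * (ℤ.+ 1 / n)   ≡⟨ cong (_* (ℤ.+ 1 / n)) np≡1 ⟩
    1ℚ * (ℤ.+ 1 / n)           ≡⟨ ℚ.*-identityˡ (ℤ.+ 1 / n) ⟩
    ℤ.+ 1 / n                  ∎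
    where open ≡-Reasoning

  1/[m*n] : ∀ m n .{{_ : ℕ.NonZero m}} .{{_ : ℕ.NonZero n}} →
    (ℤ.+ 1 / m) * (ℤ.+ 1 / n) ≡ (ℤ.+ 1 / (m ℕ.* n)) {{ℕ.m*n≢0 m n}}
  1/[m*n] m n = *-inverse-unique (m ℕ.* n) {{ℕ.m*n≢0 m n}} (begin
    ℕtoℚ (m ℕ.* n) * (u * v)      ≡⟨ cong (_* (u * v)) (ℕtoℚ-homo-* m n) ⟩
    ℕtoℚ m * ℕtoℚ n * (u * v)     ≡⟨ solve 4 (λ m n u v → m :* n :* (u :* v) := m :* u :* (n :* v)) refl (ℕtoℚ m) (ℕtoℚ n) u v ⟩
    ℕtoℚ m * u * (ℕtoℚ n * v)     ≡⟨ cong₂ _*_ (ℕtoℚ-*-inverse m) (ℕtoℚ-*-inverse n) ⟩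
    1ℚ                            ∎)
    where
    open ≡-Reasoning
    u = ℤ.+ 1 / m
    v = ℤ.+ 1 / n

  brunnMinkowski : ∀ d .{{_ : ℕ.NonZero d}} (H : Vec FiniteSet d) →
    let open BrunnMinkowski (Ω H) (ℓ₀ H) in
    (S T : Subset (Ω H)) (neS : Nonempty S) (neT : Nonempty T) →
    √ (∣ S ∣ ℕ.* ∣ T ∣) *₊ exp ((ℤ.+ 1 / 16) * (ℤ.+ 1 / d) * ℕtoℚ (d⋆ S T neS neT ℕ.^ 2)) ≤ℝ ℕtoℝ ∣ m̂ S T ∣
  brunnMinkowski d H S T neS neT = √*exp-≤ (∣ S ∣ ℕ.* ∣ T ∣) ∣ m̂ S T ∣ x 0≤x λ k →
    q*∣S∣∣T∣≤∣m̂∣² H S T neS neT {1ℚ + δ} {r} {expSum x k * expSum x k} 1≤β 0≤r βr≡1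
      (0≤* (0≤expSum 0≤x k) (0≤expSum 0≤x k))
      (expSum⁴*cosh^d≤β^D d Δ 0≤δ δ≤1 refl 0≤r βr≡1 dδ≡D 0≤x 4x≡ k)
    where
    open BrunnMinkowski (Ω H) (ℓ₀ H)
    Δ = d⋆ S T neS neT
    ι = ℤ.+ 1 / d
    δ = ℕtoℚ Δ * ι
    x = (ℤ.+ 1 / 16) * ι * ℕtoℚ (Δ ℕ.^ 2)
    instance
      d+Δ≢0 : ℕ.NonZero (d ℕ.+ Δ)
      d+Δ≢0 = ℕ.>-nonZero (ℕ.<-≤-trans (ℕ.>-nonZero⁻¹ d) (ℕ.m≤m+n d Δ))
    -- With δ = Δ/d the tilt 1 + δ is (d + Δ)/d, and `r` is its reciprocal d/(d + Δ).
    κ = ℤ.+ 1 / (d ℕ.+ Δ)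
    r = ℕtoℚ d * κ
    0≤ι : 0ℚ ≤ ι
    0≤ι = 0≤1/n d
    0≤δ : 0ℚ ≤ δ
    0≤δ = 0≤* (0≤ℕtoℚ Δ) 0≤ι
    0≤r : 0ℚ ≤ r
    0≤r = 0≤* (0≤ℕtoℚ d) (0≤1/n (d ℕ.+ Δ))
    0≤x : 0ℚ ≤ x
    0≤x = 0≤* (0≤* (0≤1/n 16) 0≤ι) (0≤ℕtoℚ (Δ ℕ.^ 2))
    1≤β : 1ℚ ≤ 1ℚ + δ
    1≤β = subst (_≤ 1ℚ + δ) (ℚ.+-identityʳ 1ℚ) (ℚ.+-monoʳ-≤ 1ℚ 0≤δ)
    δ≤1 : δ ≤ 1ℚ
    δ≤1 = subst (δ ≤_) (ℕtoℚ-*-inverse d) (*-monoʳ 0≤ι (ℕtoℚ-mono-≤ (D≤d H S T neS neT)))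
    dδ≡D : ℕtoℚ d * δ ≡ ℕtoℚ Δ
    dδ≡D = trans (solve 3 (λ d D u → d :* (D :* u) := D :* (d :* u)) refl (ℕtoℚ d) (ℕtoℚ Δ) ι)
      (trans (cong (ℕtoℚ Δ *_) (ℕtoℚ-*-inverse d)) (ℚ.*-identityʳ (ℕtoℚ Δ)))
    βr≡1 : (1ℚ + δ) * r ≡ 1ℚ
    βr≡1 = begin
      (1ℚ + δ) * (ℕtoℚ d * κ)           ≡⟨ solve 3 (λ δ d k → (con 1ℚ :+ δ) :* (d :* k) := (d :+ d :* δ) :* k) refl δ (ℕtoℚ d) κ ⟩
      (ℕtoℚ d + ℕtoℚ d * δ) * κ         ≡⟨ cong (λ z → (ℕtoℚ d + z) * κ) dδ≡D ⟩
      (ℕtoℚ d + ℕtoℚ Δ) * κ             ≡⟨ cong (_* κ) (ℕtoℚ-homo-+ d Δ) ⟨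
      ℕtoℚ (d ℕ.+ Δ) * κ                ≡⟨ ℕtoℚ-*-inverse (d ℕ.+ Δ) ⟩
      1ℚ                                ∎
      where open ≡-Reasoning
    Δ²≡ : ℕtoℚ (Δ ℕ.^ 2) ≡ ℕtoℚ Δ * ℕtoℚ Δ
    Δ²≡ = trans (cong (λ n → ℕtoℚ (Δ ℕ.* n)) (ℕ.*-identityʳ Δ)) (ℕtoℚ-homo-* Δ Δ)
    4x≡ : (x + x) + (x + x) ≡ ½ * ½ * (ℕtoℚ Δ * δ)
    4x≡ = trans (cong (λ e → let y = (ℤ.+ 1 / 16) * ι * e in (y + y) + (y + y)) Δ²≡)
      (solve 2 (λ u D → let y = con (ℤ.+ 1 / 16) :* u :* (D :* D) in
        (y :+ y) :+ (y :+ y) := con ½ :* con ½ :* (D :* (D :* u))) refl ι (ℕtoℚ Δ))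

-- The theorem with its constants.

open import Data.Integer.Base using (+_)
open import Data.Nat.Base using (NonZero; _*_; _^_)
open import Data.Nat.Properties using (m*n≢0)
open import Data.Rational.Base using () renaming (_*_ to _*ℚ_)
open MidpointCount using (brunnMinkowski; 1/[m*n])

theorem1p7 : (d : ℕ) .{{_ : NonZero d}} (H : Vec FiniteSet d) → All Inhabited H →
    let open BrunnMinkowski (Ω H) (ℓ₀ H) in
    CurvatureAtLeast ((+ 1 / (2 * d)) {{m*n≢0 2 d}})
    × ((S T : Subset (Ω H)) (neS : Nonempty S) (neT : Nonempty T) →
    √ (∣ S ∣ * ∣ T ∣) *₊ exp ((+ 1 / (16 * d)) {{m*n≢0 16 d}} *ℚ ℕtoℚ (d⋆ S T neS neT ^ 2))
    ≤ℝ ℕtoℝ ∣ m̂ S T ∣)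
theorem1p7 d H _ =
  -- The value 1/2d is itself an admissible K, so every upper bound of the admissible values is at
  -- least 1/2d.
  (λ U isUpperBound → isUpperBound ((+ 1 / (2 * d)) {{m*n≢0 2 d}}) (inequality K≡)) ,
  inequality (1/[m*n] 16 d)
  where
  open BrunnMinkowski (Ω H) (ℓ₀ H)
  -- Both conjuncts are the same inequality with the coefficient 1/16 · 1/d written differently,
  -- once as 1/2d · 1/8 and once as 1/(16d).
  inequality : ∀ {c} → (+ 1 / 16) *ℚ (+ 1 / d) ≡ c → (S T : Subset (Ω H)) (neS : Nonempty S) (neT : Nonempty T) →
    √ (∣ S ∣ * ∣ T ∣) *₊ exp (c *ℚ ℕtoℚ (d⋆ S T neS neT ^ 2)) ≤ℝ ℕtoℝ ∣ m̂ S T ∣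
  inequality refl = brunnMinkowski d H
  K≡ : (+ 1 / 16) *ℚ (+ 1 / d) ≡ (+ 1 / (2 * d)) {{m*n≢0 2 d}} *ℚ (+ 1 / 8)
  K≡ = begin
    (+ 1 / 16) *ℚ (+ 1 / d)                              ≡⟨ solve 1 (λ u → con (+ 1 / 16) :* u := con (+ 1 / 2) :* u :* con (+ 1 / 8)) refl (+ 1 / d) ⟩
    (+ 1 / 2) *ℚ (+ 1 / d) *ℚ (+ 1 / 8)                  ≡⟨ cong (_*ℚ (+ 1 / 8)) (1/[m*n] 2 d) ⟩
    (+ 1 / (2 * d)) {{m*n≢0 2 d}} *ℚ (+ 1 / 8)           ∎
    where
    open ≡-Reasoning
    open +-*-Solver
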